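{- Let $1\le r<k$ be integers. Suppose that $U_r$ consists of all inequivalent binary self-dual $[2r,r]$ codes, i.e. $U_r$ contains exactly one code from every equivalence class of binary self-dual $[2r,r]$ codes. Then the algorithm described in the context (with input set $U_r$ and target dimension $k$) generates all inequivalent binary self-dual $[2k,k]$ codes, i.e. its output $U_k$ contains exactly one code from every equivalence class of binary self-dual $[2k,k]$ codes.
   Context: All codes are binary linear codes; a self-dual code of dimension $k$ has length $2k$. A permutation $\sigma\in S_n$ acts on a code of length $n$ by moving coordinate $i$ to position $\sigma(i)$. Two codes are equivalent ($\cong$) if one is the image of the other under a coordinate permutation; $\mathrm{Aut}(C)=\{\sigma: \sigma(C)=C\}$. Two coordinates $i,j$ of a code $C$ are called equal if $x_i=x_j$ for all $x\in C$. Canonical forms. Let $\Omega_k$ be the set of all binary self-dual codes of dimension $k$. For each $k\ge 2$ a canonical representative map is fixed: a function $\rho:\Omega_k\to\Omega_k$ with $\rho(X)\cong X$ for all $X$, and $\rho(X)=\rho(Y)$ whenever $X\cong Y$; it is assumed to be chosen so that the last two coordinates of every code $\rho(X)$ are not equal. A canonical permutation of $B\in\Omega_k$ is any $\phi\in S_{2k}$ with $\phi(B)=\rho(B)$. Parent test. Given a canonical permutation $\phi_B$ of $B\in\Omega_k$, let $c_1,c_2$ be the coordinates with $\phi_B(c_1)=2k$, $\phi_B(c_2)=2k-1$. The code $B$ passes the parent test if there is $\sigma\in\mathrm{Aut}(B)$ with $\{\sigma(c_1),\sigma(c_2)\}=\{2k-1,2k\}$; equivalently, if there is a canonical permutation $\phi$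 of $B$ with $\{\phi(2k-1),\phi(2k)\}=\{2k-1,2k\}$. Child type codes. Let $A$ be a self-dual $[2k-2,k-1]$ code with a generator matrix $G_A$ in systematic form (i.e. containing the identity matrix $I_{k-1}$ in the columns of some information set). For $a=(a_1,\dots,a_{k-1})\in\mathbb{F}_2^{k-1}$ of odd weight, let $C_0$ be the code of length $2k$ generated by $(G_A\mid a^T\ a^T)$, and let $x\in\mathbb{F}_2^{2k}$ be the vector with $x_{2k-1}=1$, $x_{2k}=0$, whose entries in the information positions of $G_A$ are $a_1,\dots,a_{k-1}$ and whose other entries are $0$. The code $\langle C_0,x\rangle$ is a self-dual $[2k,k]$ code, the child type code of $A$ defined by $a$. Each automorphism $P$ of $A$ (as a permutation matrix) determines the invertible matrix $A_P\in\mathrm{GL}(k-1,2)$ with $G_AP=A_PG_A$, and $\mathrm{Aut}(A)$ acts on the odd-weight vectors of $\mathbb{F}_2^{k-1}$ via $a^T\mapsto A_Pa^T$. $Child(A)$ denotes the set of child type codes of $A$ obtained by taking one representative vector $a$ from each orbit of this action. Algorithm. Input: a nonempty set $U_r$ of binary self-dual $[2r,r]$ codes and an integer $k>r$. Output: a set $U_k$ of self-dual $[2k,k]$ codes. Start with $U_k=\emptyset$ and call Augmentation$(A)$ for every $A\in U_r$, where Augmentation$(A)$ is the recursive procedure: if $\dim A=k$, add $A$ to $U_k$; if $\dim A<k$, compute $Child(A)$, and for every $B\in Child(A)$ that passes the parent test, call Augmentation$(B)$. -}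

module Defs where

open import Data.Bool.Base using (if_then_else_)
open import Data.Fin.Base using (Fin; fromℕ; inject₁)
open import Data.Fin.Permutation using (Permutation′; _⟨$⟩ʳ_; _⟨$⟩ˡ_)
open import Data.Fin.Properties using (any?) renaming (_≟_ to _≟ᶠ_)
open import Data.Fin.Subset using (⁅_⁆; _∪_)
open import Data.Nat.Base using (ℕ; suc; _*_; _<_; parity) renaming (_+_ to _+ℕ_)
open import Data.Parity.Base using (Parity; 0ℙ; 1ℙ) renaming (_+_ to _+₂_; _*_ to _*₂_)
open import Data.Parity.Properties using () renaming (_≟_ to _≟₂_)
open import Data.Product using (∃; ∃-syntax; ∃!; _×_; _,_)
open import Data.Vec.Base
  using (Vec; []; _∷_; _∷ʳ_; lookup; tabulate; map; zipWith; foldr′; replicate; count)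
open import Level using (Level; 0ℓ; _⊔_) renaming (suc to lsuc)
open import Relation.Binary.PropositionalEquality.Core using (_≡_)
open import Relation.Nullary using (¬_; yes; no; does)
open import Relation.Unary using (Pred; _∈_; _⊆_; _≐_)

private
  variable
    m n k r : ℕ
    ℓ : Level

------------------------------------------------------------------------
-- Linear algebra over 𝔽₂

𝔽₂ : Set
𝔽₂ = Parity

-- Matrix m n: m rows of length n.
Matrix : ℕ → ℕ → Set
Matrix m n = Vec (Vec 𝔽₂ n) m

𝟎 : Vec 𝔽₂ n
𝟎 = replicate _ 0ℙ

infixl 6 _⊕_
_⊕_ : Vec 𝔽₂ n → Vec 𝔽₂ n → Vec 𝔽₂ n
_⊕_ = zipWith _+₂_

infix 7 _∙_
_∙_ : Vec 𝔽₂ n → Vec 𝔽₂ n → 𝔽₂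
x ∙ y = foldr′ _+₂_ 0ℙ (zipWith _*₂_ x y)

weight : Vec 𝔽₂ n → ℕ
weight = count (_≟₂ 1ℙ)

OddWeight : Pred (Vec 𝔽₂ n) 0ℓ
OddWeight a = parity (weight a) ≡ 1ℙ

-- The row vector c G, i.e. the sum of the rows of G with coefficients c.
infixr 7 _ᵛ*ᴹ_
_ᵛ*ᴹ_ : Vec 𝔽₂ m → Matrix m n → Vec 𝔽₂ n
c ᵛ*ᴹ G = foldr′ _⊕_ 𝟎 (zipWith (λ cᵢ → map (cᵢ *₂_)) c G)

infixr 7 _ᴹ*ᴹ_
_ᴹ*ᴹ_ : Matrix m n → Matrix n k → Matrix m k
M ᴹ*ᴹ G = map (_ᵛ*ᴹ G) M

-- The column vector M aᵀ.
infixr 7 _ᴹ*ᵛ_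
_ᴹ*ᵛ_ : Matrix m n → Vec 𝔽₂ n → Vec 𝔽₂ m
M ᴹ*ᵛ a = map (_∙ a) M

RowSpace : Matrix m n → Pred (Vec 𝔽₂ n) 0ℓ
RowSpace G x = ∃[ c ] c ᵛ*ᴹ G ≡ x

LinearlyIndependent : Matrix m n → Set
LinearlyIndependent G = ∀ c → c ᵛ*ᴹ G ≡ 𝟎 → c ≡ 𝟎

------------------------------------------------------------------------
-- Codes and coordinate permutations

-- Over 𝔽₂, closure under scalars is automatic from the two fields below.
record LinearCode (n : ℕ) : Set₁ where
  field
    Codeword : Pred (Vec 𝔽₂ n) 0ℓ
    𝟎∈       : 𝟎 ∈ Codeword
    ⊕-closed : ∀ {x y} → x ∈ Codeword → y ∈ Codeword → x ⊕ y ∈ Codeword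

open LinearCode public using (Codeword)

IsGeneratorMatrix : Matrix k n → LinearCode n → Set
IsGeneratorMatrix G C = Codeword C ≐ RowSpace G × LinearlyIndependent G

HasDimension : LinearCode n → ℕ → Set
HasDimension {n} C k = ∃[ G ] IsGeneratorMatrix {k} {n} G C

Dual : LinearCode n → Pred (Vec 𝔽₂ n) 0ℓ
Dual C y = ∀ x → x ∈ Codeword C → x ∙ y ≡ 0ℙ

EqualCoordinates : LinearCode n → Fin n → Fin n → Set
EqualCoordinates C i j = ∀ x → x ∈ Codeword C → lookup x i ≡ lookup x j

-- Entry i of x becomes entry σ(i) of permute σ x.
permute : Permutation′ n → Vec 𝔽₂ n → Vec 𝔽₂ n
permute σ x = tabulate λ j → lookup x (σ ⟨$⟩ˡ j)

Image : Permutation′ n → LinearCode n → Pred (Vec 𝔽₂ n) 0ℓ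
Image σ C y = ∃[ x ] x ∈ Codeword C × permute σ x ≡ y

IsAutomorphism : LinearCode n → Pred (Permutation′ n) 0ℓ
IsAutomorphism C σ = Image σ C ≐ Codeword C

-- The length is written k * 2, rather than 2 * k, because suc k * 2 reduces
-- to 2 + k * 2: a child code is two coordinates longer than its parent.
record Ω (k : ℕ) : Set₁ where
  field
    code      : LinearCode (k * 2)
    selfDual  : Codeword code ≐ Dual code
    dimension : HasDimension code k

open Ω public using (code)

-- Equality of codes as sets of vectors.
infix 4 _≈_
_≈_ : Ω k → Ω k → Set
X ≈ Y = Codeword (code X) ≐ Codeword (code Y)

infix 4 _≅_
_≅_ : Ω k → Ω k → Set
X ≅ Y = ∃[ σ ] Image σ (code X) ≐ Codeword (code Y)

-- U contains exactly one code from every equivalence class.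
AllInequivalent : Pred (Ω k) ℓ → Set (lsuc 0ℓ ⊔ ℓ)
AllInequivalent U = ∀ X → ∃! _≈_ (λ B → B ∈ U × B ≅ X)

------------------------------------------------------------------------
-- Canonical forms and the parent test

last penultimate : Fin (2 +ℕ n)
last        = fromℕ _
penultimate = inject₁ (fromℕ _)

-- A canonical representative map in every dimension 2 + k.
record CanonicalForm : Set₁ where
  field
    ρ          : Ω (2 +ℕ k) → Ω (2 +ℕ k)
    ρ-≅        : (X : Ω (2 +ℕ k)) → ρ X ≅ X
    ρ-cong     : {X Y : Ω (2 +ℕ k)} → X ≅ Y → ρ X ≈ ρ Y
    ρ-lastTwo  : (X : Ω (2 +ℕ k)) → ¬ EqualCoordinates (code (ρ X)) penultimate last

  IsCanonicalPermutation : Ω (2 +ℕ k) → Pred (Permutation′ ((2 +ℕ k) * 2)) 0ℓ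
  IsCanonicalPermutation B φ = Image φ (code B) ≐ Codeword (code (ρ B))

ParentTest : (B : Ω (suc k)) → Permutation′ (suc k * 2) → Set
ParentTest B φ =
  let c₁ = φ ⟨$⟩ˡ last
      c₂ = φ ⟨$⟩ˡ penultimate
  in ∃[ σ ] IsAutomorphism (code B) σ
          × ⁅ σ ⟨$⟩ʳ c₁ ⁆ ∪ ⁅ σ ⟨$⟩ʳ c₂ ⁆ ≡ ⁅ penultimate ⁆ ∪ ⁅ last ⁆

------------------------------------------------------------------------
-- Child type codes

-- Column position i of the generator matrix is the i-th unit vector, so
-- these columns form an identity matrix.
record SystematicGenerator (C : LinearCode n) (k : ℕ) : Set where
  field
    G           : Matrix k n
    isGenerator : IsGeneratorMatrix G C
    position    : Fin k → Fin n
    identity    : ∀ i j → lookup (lookup G i) (position j)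
                          ≡ (if does (i ≟ᶠ j) then 1ℙ else 0ℙ)

-- The vector with entry aᵢ in position i, and 0 outside these positions.
scatter : (Fin k → Fin n) → Vec 𝔽₂ k → Vec 𝔽₂ n
scatter position a = tabulate entry
  where
  entry : Fin _ → 𝔽₂
  entry p with any? (λ i → position i ≟ᶠ p)
  ... | yes (i , _) = lookup a i
  ... | no  _       = 0ℙ

module _ {C : LinearCode n} (S : SystematicGenerator C k) where
  open SystematicGenerator S

  -- (G ∣ aᵀ aᵀ)
  extendedMatrix : Vec 𝔽₂ k → Matrix k (2 +ℕ n)
  extendedMatrix a = zipWith (λ g aᵢ → g ∷ʳ aᵢ ∷ʳ aᵢ) G a

  extraVector : Vec 𝔽₂ k → Vec 𝔽₂ (2 +ℕ n)
  extraVector a = scatter position a ∷ʳ 1ℙ ∷ʳ 0ℙ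

  ChildTypeCode : Vec 𝔽₂ k → Pred (Vec 𝔽₂ (2 +ℕ n)) 0ℓ
  ChildTypeCode a = RowSpace (extraVector a ∷ extendedMatrix a)

  -- a and b lie in one orbit of Aut(C).  Applying σ to each row of G is the
  -- product G P, and the rows of G being independent, M is the unique matrix
  -- with G P = M G.
  SameOrbit : Vec 𝔽₂ k → Vec 𝔽₂ k → Set
  SameOrbit a b = ∃[ σ ] IsAutomorphism C σ
                × ∃[ M ] map (permute σ) G ≡ M ᴹ*ᴹ G × M ᴹ*ᵛ a ≡ b

record ChildChoice (A : Ω k) : Set₁ where
  field
    systematic    : SystematicGenerator (code A) k
    Reps          : Pred (Vec 𝔽₂ k) 0ℓ
    reps-odd      : Reps ⊆ OddWeight
    reps-perOrbit : ∀ a → a ∈ OddWeight →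
                    ∃! _≡_ (λ b → b ∈ Reps × SameOrbit systematic a b)

  Child : Pred (Ω (suc k)) 0ℓ
  Child B = ∃[ a ] a ∈ Reps × Codeword (code B) ≐ ChildTypeCode systematic a

------------------------------------------------------------------------
-- The algorithm

-- The choices made when running the algorithm.  As Ω is a setoid under _≈_,
-- child-cong is what makes Child(A) depend only on A as a set of vectors.
record Choices (cf : CanonicalForm) : Set₁ where
  open CanonicalForm cf
  field
    φ           : (B : Ω (2 +ℕ k)) → Permutation′ ((2 +ℕ k) * 2)
    φ-canonical : (B : Ω (2 +ℕ k)) → IsCanonicalPermutation B (φ B)
    childChoice : (A : Ω k) → ChildChoice A

  Child : Ω k → Pred (Ω (suc k)) 0ℓ
  Child A = ChildChoice.Child (childChoice A)

  field
    child-cong : {A A′ : Ω k} → A ≈ A′ → Child A ≐ Child A′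

  PassesParentTest : Pred (Ω (2 +ℕ k)) 0ℓ
  PassesParentTest B = ParentTest B (φ B)

  -- Augmentation k A consists of the codes added to the output by the call
  -- Augmentation(A) with target dimension k.  Recursion starts in dimension
  -- at least 1, as canonical forms are available from dimension 2 only.
  data Augmentation (k : ℕ) : Ω m → Pred (Ω k) (lsuc 0ℓ) where
    add     : {A : Ω k} → A ∈ Augmentation k A
    recurse : {A : Ω (suc m)} {B : Ω (2 +ℕ m)} {D : Ω k} →
              suc m < k → B ∈ Child A → PassesParentTest B →
              D ∈ Augmentation k B → D ∈ Augmentation k A

  Output : Pred (Ω r) ℓ → (k : ℕ) → Pred (Ω k) (lsuc 0ℓ ⊔ ℓ)
  Output U k D = ∃[ A ] A ∈ U × D ∈ Augmentation k A

{-# OPTIONS --safe #-}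
module Submission where

-- Deleting the last two coordinates from the codewords in which they agree turns
-- a self-dual code whose last two coordinates are not equal into its parent.
-- Up to swapping these coordinates, such a code is the child type code of its
-- parent A given by the unique vector a for which all rows (gᵢ ∣ aᵢ aᵢ) are
-- codewords.  An equivalence of two such codes that preserves the set of the last
-- two coordinates restricts to an equivalence of the parents; if the parents agree,
-- it is an automorphism of A moving one vector to the other.
--
-- Existence: ρ X has a parent, hence after permuting the other coordinates it has a
-- parent A produced by the algorithm, and then it is a chosen child of A, on which
-- the canonical permutation can be taken to preserve the last two coordinates.
-- Uniqueness: two equivalent codes passing the parent test are equivalent by a
-- permutation preserving the last two coordinates, so their parents are equivalent,
-- hence equal, and the codes come from the same orbit.

open import Defs
open import Data.Nat.Base using (ℕ; _≤_; _<_)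
open import Level using (Level)
open import Relation.Unary using (Pred; Satisfiable)

open import Algebra.Properties.CommutativeMonoid.Sum using (sum; sum-permute; sum-cong-≗)
open import Algebra.Properties.CommutativeSemigroup using (interchange)
open import Data.Empty using (⊥-elim)
open import Data.Fin.Base using (Fin; zero; suc; fromℕ; inject₁; punchIn)
open import Data.Fin.Permutation as Perm
  using (Permutation′; _⟨$⟩ʳ_; _⟨$⟩ˡ_; inverseˡ; inverseʳ; _∘ₚ_; flip)
open import Data.Fin.Properties
  using (any?; fromℕ≢inject₁; inject₁-injective) renaming (_≟_ to _≟ᶠ_)
open import Data.Fin.Relation.Unary.Top using (view; ‵fromℕ; ‵inject₁)
open import Data.Fin.Subset using (⁅_⁆; _∪_) renaming (_∈_ to _∈ˢ_)
open import Data.Fin.Subset.Properties using (x∈⁅x⁆; x∈⁅y⁆⇒x≡y; x∈p∪q⁻; x∈p∪q⁺; ∪-comm)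
open import Data.Nat.Base using (suc; zero; s≤s; _*_; parity) renaming (_+_ to _+ℕ_)
open import Data.Nat.Properties using (<⇒≤; <-trans; <-irrefl; m≤n⇒m<n∨m≡n; n<1+n)
open import Data.Parity.Base
  using (0ℙ; 1ℙ; _⁻¹) renaming (_+_ to infixl 6 _+₂_; _*_ to infixl 7 _*₂_)
import Data.Parity.Properties as ℙ
open import Data.Product using (∃; ∃!; ∃-syntax; _×_; _,_; proj₁; proj₂)
open import Data.Sum using (_⊎_; inj₁; inj₂)
open import Data.Vec.Base
  using (Vec; []; _∷_; _∷ʳ_; lookup; tabulate; map; zipWith; initLast)
open import Data.Vec.Properties
open import Function using (_∘_; id; case_of_)
open import Relation.Binary.PropositionalEquality
open import Relation.Nullary using (¬_; yes; no)
open import Relation.Unary using (_∈_; _≐_)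
open ≡-Reasoning

private
  variable
    m n k : ℕ

-- Linear algebra over 𝔽₂

lookup-ext : {A : Set} {x y : Vec A n} → (∀ i → lookup x i ≡ lookup y i) → x ≡ y
lookup-ext {x = x} {y} eq = begin
  x                    ≡⟨ tabulate∘lookup x ⟨
  tabulate (lookup x)  ≡⟨ tabulate-cong eq ⟩
  tabulate (lookup y)  ≡⟨ tabulate∘lookup y ⟩
  y                    ∎

+₂-interchange : ∀ a b c d → (a +₂ b) +₂ (c +₂ d) ≡ (a +₂ c) +₂ (b +₂ d)
+₂-interchange = interchange ℙ.+-commutativeSemigroup

p+q≡0⇒p≡q : ∀ p q → p +₂ q ≡ 0ℙ → p ≡ q
p+q≡0⇒p≡q 0ℙ 0ℙ _ = refl
p+q≡0⇒p≡q 1ℙ 1ℙ _ = refl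

⊕-assoc : (x y z : Vec 𝔽₂ n) → (x ⊕ y) ⊕ z ≡ x ⊕ (y ⊕ z)
⊕-assoc = zipWith-assoc ℙ.+-assoc

⊕-identityˡ : (x : Vec 𝔽₂ n) → 𝟎 ⊕ x ≡ x
⊕-identityˡ = zipWith-identityˡ ℙ.+-identityˡ

⊕-self : (x : Vec 𝔽₂ n) → x ⊕ x ≡ 𝟎
⊕-self []       = refl
⊕-self (p ∷ x)  = cong₂ _∷_ (ℙ.p+p≡0ℙ p) (⊕-self x)

⊕-cancel : (x y : Vec 𝔽₂ n) → x ⊕ (x ⊕ y) ≡ y
⊕-cancel x y = begin
  x ⊕ (x ⊕ y)  ≡⟨ ⊕-assoc x x y ⟨
  (x ⊕ x) ⊕ y  ≡⟨ cong (_⊕ y) (⊕-self x) ⟩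
  𝟎 ⊕ y        ≡⟨ ⊕-identityˡ y ⟩
  y            ∎

⊕-interchange : (a b c d : Vec 𝔽₂ n) → (a ⊕ b) ⊕ (c ⊕ d) ≡ (a ⊕ c) ⊕ (b ⊕ d)
⊕-interchange []      []      []      []      = refl
⊕-interchange (p ∷ a) (q ∷ b) (r ∷ c) (s ∷ d) =
  cong₂ _∷_ (+₂-interchange p q r s) (⊕-interchange a b c d)

scale-0 : (x : Vec 𝔽₂ n) → map (0ℙ *₂_) x ≡ 𝟎
scale-0 x = map-const x 0ℙ

scale-1 : (x : Vec 𝔽₂ n) → map (1ℙ *₂_) x ≡ x
scale-1 = map-id

scale-+ : ∀ p q (x : Vec 𝔽₂ n) → map ((p +₂ q) *₂_) x ≡ map (p *₂_) x ⊕ map (q *₂_) x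
scale-+ p q []      = refl
scale-+ p q (r ∷ x) = cong₂ _∷_ (ℙ.*-distribʳ-+ r p q) (scale-+ p q x)

∙-comm : (x y : Vec 𝔽₂ n) → x ∙ y ≡ y ∙ x
∙-comm []      []      = refl
∙-comm (p ∷ x) (q ∷ y) = cong₂ _+₂_ (ℙ.*-comm p q) (∙-comm x y)

∙-distribʳ : (z x y : Vec 𝔽₂ n) → (x ⊕ y) ∙ z ≡ x ∙ z +₂ y ∙ z
∙-distribʳ []      []      []      = refl
∙-distribʳ (r ∷ z) (p ∷ x) (q ∷ y) = begin
  (p +₂ q) *₂ r +₂ (x ⊕ y) ∙ z
    ≡⟨ cong₂ _+₂_ (ℙ.*-distribʳ-+ r p q) (∙-distribʳ z x y) ⟩
  (p *₂ r +₂ q *₂ r) +₂ (x ∙ z +₂ y ∙ z)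
    ≡⟨ +₂-interchange (p *₂ r) (q *₂ r) (x ∙ z) (y ∙ z) ⟩
  (p *₂ r +₂ x ∙ z) +₂ (q *₂ r +₂ y ∙ z) ∎

∙-zeroˡ : (x : Vec 𝔽₂ n) → 𝟎 ∙ x ≡ 0ℙ
∙-zeroˡ []      = refl
∙-zeroˡ (_ ∷ x) = ∙-zeroˡ x

∙-zeroʳ : (x : Vec 𝔽₂ n) → x ∙ 𝟎 ≡ 0ℙ
∙-zeroʳ x = trans (∙-comm x 𝟎) (∙-zeroˡ x)

∙-scaleˡ : ∀ p (x y : Vec 𝔽₂ n) → map (p *₂_) x ∙ y ≡ p *₂ (x ∙ y)
∙-scaleˡ 0ℙ x y = trans (cong (_∙ y) (scale-0 x)) (∙-zeroˡ y)
∙-scaleˡ 1ℙ x y = cong (_∙ y) (scale-1 x)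

∙-∷ʳ : (x y : Vec 𝔽₂ n) (p q : 𝔽₂) → (x ∷ʳ p) ∙ (y ∷ʳ q) ≡ x ∙ y +₂ p *₂ q
∙-∷ʳ []      []      p q = ℙ.+-identityʳ _
∙-∷ʳ (r ∷ x) (s ∷ y) p q = begin
  r *₂ s +₂ (x ∷ʳ p) ∙ (y ∷ʳ q)   ≡⟨ cong (r *₂ s +₂_) (∙-∷ʳ x y p q) ⟩
  r *₂ s +₂ (x ∙ y +₂ p *₂ q)     ≡⟨ ℙ.+-assoc (r *₂ s) (x ∙ y) (p *₂ q) ⟨
  (r *₂ s +₂ x ∙ y) +₂ p *₂ q     ∎

⊕-∷ʳ : (x y : Vec 𝔽₂ n) (p q : 𝔽₂) → (x ∷ʳ p) ⊕ (y ∷ʳ q) ≡ (x ⊕ y) ∷ʳ (p +₂ q)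
⊕-∷ʳ []      []      p q = refl
⊕-∷ʳ (r ∷ x) (s ∷ y) p q = cong (r +₂ s ∷_) (⊕-∷ʳ x y p q)

𝟎-∷ʳ : ∀ n → 𝟎 {n} ∷ʳ 0ℙ ≡ 𝟎
𝟎-∷ʳ zero    = refl
𝟎-∷ʳ (suc n) = cong (0ℙ ∷_) (𝟎-∷ʳ n)

ᵛ*ᴹ-∙ : (c : Vec 𝔽₂ m) (G : Matrix m n) (y : Vec 𝔽₂ n) → (c ᵛ*ᴹ G) ∙ y ≡ c ∙ (G ᴹ*ᵛ y)
ᵛ*ᴹ-∙ []      []      y = ∙-zeroˡ y
ᵛ*ᴹ-∙ (p ∷ c) (g ∷ G) y = begin
  (map (p *₂_) g ⊕ c ᵛ*ᴹ G) ∙ y            ≡⟨ ∙-distribʳ y (map (p *₂_) g) (c ᵛ*ᴹ G) ⟩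
  map (p *₂_) g ∙ y +₂ (c ᵛ*ᴹ G) ∙ y       ≡⟨ cong₂ _+₂_ (∙-scaleˡ p g y) (ᵛ*ᴹ-∙ c G y) ⟩
  p *₂ (g ∙ y) +₂ c ∙ (G ᴹ*ᵛ y)            ∎

ᵛ*ᴹ-distribʳ : (c d : Vec 𝔽₂ m) (G : Matrix m n) → (c ⊕ d) ᵛ*ᴹ G ≡ c ᵛ*ᴹ G ⊕ d ᵛ*ᴹ G
ᵛ*ᴹ-distribʳ []      []      []      = sym (⊕-identityˡ 𝟎)
ᵛ*ᴹ-distribʳ (p ∷ c) (q ∷ d) (g ∷ G) = begin
  map ((p +₂ q) *₂_) g ⊕ (c ⊕ d) ᵛ*ᴹ G
    ≡⟨ cong₂ _⊕_ (scale-+ p q g) (ᵛ*ᴹ-distribʳ c d G) ⟩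
  (map (p *₂_) g ⊕ map (q *₂_) g) ⊕ (c ᵛ*ᴹ G ⊕ d ᵛ*ᴹ G)
    ≡⟨ ⊕-interchange (map (p *₂_) g) _ _ _ ⟩
  (map (p *₂_) g ⊕ c ᵛ*ᴹ G) ⊕ (map (q *₂_) g ⊕ d ᵛ*ᴹ G) ∎

lookup-scale : ∀ p (x : Vec 𝔽₂ n) i → lookup (map (p *₂_) x) i ≡ p *₂ lookup x i
lookup-scale p x i = lookup-map i (p *₂_) x

lookup-ᵛ*ᴹ : (c : Vec 𝔽₂ m) (G : Matrix m n) (i : Fin n) →
             lookup (c ᵛ*ᴹ G) i ≡ c ∙ map (λ g → lookup g i) G
lookup-ᵛ*ᴹ []      []      i = lookup-replicate i 0ℙ
lookup-ᵛ*ᴹ (p ∷ c) (g ∷ G) i = begin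
  lookup (map (p *₂_) g ⊕ c ᵛ*ᴹ G) i
    ≡⟨ lookup-zipWith _+₂_ i (map (p *₂_) g) (c ᵛ*ᴹ G) ⟩
  lookup (map (p *₂_) g) i +₂ lookup (c ᵛ*ᴹ G) i
    ≡⟨ cong₂ _+₂_ (lookup-scale p g i) (lookup-ᵛ*ᴹ c G i) ⟩
  p *₂ lookup g i +₂ c ∙ map (λ h → lookup h i) G ∎

unit : Fin n → Vec 𝔽₂ n
unit zero    = 1ℙ ∷ 𝟎
unit (suc i) = 0ℙ ∷ unit i

unit-∙ : (i : Fin n) (x : Vec 𝔽₂ n) → unit i ∙ x ≡ lookup x i
unit-∙ zero    (p ∷ x) = trans (cong (p +₂_) (∙-zeroˡ x)) (ℙ.+-identityʳ p)
unit-∙ (suc i) (p ∷ x) = unit-∙ i x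

lookup-unit : (i : Fin n) → lookup (unit i) i ≡ 1ℙ
lookup-unit zero    = refl
lookup-unit (suc i) = lookup-unit i

lookup-unit-≢ : {i j : Fin n} → i ≢ j → lookup (unit i) j ≡ 0ℙ
lookup-unit-≢ {i = zero}  {zero}  i≢j = ⊥-elim (i≢j refl)
lookup-unit-≢ {i = zero}  {suc j} i≢j = lookup-replicate j 0ℙ
lookup-unit-≢ {i = suc i} {zero}  i≢j = refl
lookup-unit-≢ {i = suc i} {suc j} i≢j = lookup-unit-≢ (i≢j ∘ cong suc)

identityMatrix : ∀ n → Matrix n n
identityMatrix n = tabulate unit

lookup-unit-sym : (i j : Fin n) → lookup (unit i) j ≡ lookup (unit j) i
lookup-unit-sym i j with i ≟ᶠ j
... | yes refl = refl
... | no  i≢j  = trans (lookup-unit-≢ i≢j) (sym (lookup-unit-≢ (i≢j ∘ sym)))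

ᵛ*ᴹ-identity : (c : Vec 𝔽₂ n) → c ᵛ*ᴹ identityMatrix n ≡ c
ᵛ*ᴹ-identity {n} c = lookup-ext λ i → begin
  lookup (c ᵛ*ᴹ identityMatrix n) i               ≡⟨ lookup-ᵛ*ᴹ c (identityMatrix n) i ⟩
  c ∙ map (λ g → lookup g i) (tabulate unit)      ≡⟨ cong (c ∙_) (column i) ⟩
  c ∙ unit i                                      ≡⟨ ∙-comm c (unit i) ⟩
  unit i ∙ c                                      ≡⟨ unit-∙ i c ⟩
  lookup c i                                      ∎
  where
  column : ∀ i → map (λ g → lookup g i) (tabulate unit) ≡ unit i
  column i = begin
    map (λ g → lookup g i) (tabulate unit)  ≡⟨ tabulate-∘ _ unit ⟨
    tabulate (λ j → lookup (unit j) i)      ≡⟨ tabulate-cong (λ j → lookup-unit-sym j i) ⟩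
    tabulate (lookup (unit i))              ≡⟨ tabulate∘lookup (unit i) ⟩
    unit i                                  ∎

-- Additive maps, dimension and hyperplanes

Additive : (Vec 𝔽₂ m → Vec 𝔽₂ n) → Set
Additive f = ∀ x y → f (x ⊕ y) ≡ f x ⊕ f y

module _ {f : Vec 𝔽₂ m → Vec 𝔽₂ n} (add : Additive f) where

  additive-𝟎 : f 𝟎 ≡ 𝟎
  additive-𝟎 = begin
    f 𝟎                  ≡⟨ ⊕-cancel (f 𝟎) (f 𝟎) ⟨
    f 𝟎 ⊕ (f 𝟎 ⊕ f 𝟎)    ≡⟨ cong (f 𝟎 ⊕_) (add 𝟎 𝟎) ⟨
    f 𝟎 ⊕ f (𝟎 ⊕ 𝟎)      ≡⟨ cong (λ x → f 𝟎 ⊕ f x) (⊕-identityˡ 𝟎) ⟩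
    f 𝟎 ⊕ f 𝟎            ≡⟨ ⊕-self (f 𝟎) ⟩
    𝟎                    ∎

  -- Over `𝔽₂` the only scalars are 0 and 1, so additivity alone gives linearity.
  additive-scale : ∀ p x → f (map (p *₂_) x) ≡ map (p *₂_) (f x)
  additive-scale 0ℙ x = begin
    f (map (0ℙ *₂_) x)   ≡⟨ cong f (scale-0 x) ⟩
    f 𝟎                  ≡⟨ additive-𝟎 ⟩
    𝟎                    ≡⟨ scale-0 (f x) ⟨
    map (0ℙ *₂_) (f x)   ∎
  additive-scale 1ℙ x = trans (cong f (scale-1 x)) (sym (scale-1 (f x)))

  additive-ᵛ*ᴹ : (c : Vec 𝔽₂ k) (G : Matrix k m) → f (c ᵛ*ᴹ G) ≡ c ᵛ*ᴹ map f G
  additive-ᵛ*ᴹ []      []      = additive-𝟎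
  additive-ᵛ*ᴹ (p ∷ c) (g ∷ G) =
    trans (add _ (c ᵛ*ᴹ G)) (cong₂ _⊕_ (additive-scale p g) (additive-ᵛ*ᴹ c G))

matrixOf : (Vec 𝔽₂ m → Vec 𝔽₂ n) → Matrix m n
matrixOf f = map f (identityMatrix _)

ᵛ*ᴹ-matrixOf : {f : Vec 𝔽₂ m → Vec 𝔽₂ n} → Additive f → ∀ c → c ᵛ*ᴹ matrixOf f ≡ f c
ᵛ*ᴹ-matrixOf {f = f} add c =
  trans (sym (additive-ᵛ*ᴹ add c (identityMatrix _))) (cong f (ᵛ*ᴹ-identity c))

-- The images of the unit vectors form a basis, so a linear parametrization of a code by `k` bits
-- determines its dimension.
hasDimension : (C : LinearCode n) (f : Vec 𝔽₂ k → Vec 𝔽₂ n) → Additive f →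
               (∀ c → f c ≡ 𝟎 → c ≡ 𝟎) → (∀ c → f c ∈ Codeword C) →
               (∀ {x} → x ∈ Codeword C → ∃[ c ] f c ≡ x) → HasDimension C k
hasDimension C f add injective image surjective =
  matrixOf f
  , ((λ x∈C → let c , fc≡x = surjective x∈C in c , trans (ᵛ*ᴹ-matrixOf add c) fc≡x)
    , λ (c , eq) → subst (Codeword C) (trans (sym (ᵛ*ᴹ-matrixOf add c)) eq) (image c))
  , λ c eq → injective c (trans (sym (ᵛ*ᴹ-matrixOf add c)) eq)

-- The kernel of the functional `_∙ v`, parametrized by one bit fewer, together with a vector off
-- it. Below, `v` collects the pairings of the generators of a code with `lastTwo`.
record Hyperplane (v : Vec 𝔽₂ (suc k)) : Set where
  field
    embed      : Vec 𝔽₂ k → Vec 𝔽₂ (suc k)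
    additive   : Additive embed
    injective  : ∀ c → embed c ≡ 𝟎 → c ≡ 𝟎
    orthogonal : ∀ c → embed c ∙ v ≡ 0ℙ
    surjective : ∀ d → d ∙ v ≡ 0ℙ → ∃[ c ] embed c ≡ d
    outside    : Vec 𝔽₂ (suc k)
    outside-∙  : outside ∙ v ≡ 1ℙ

-- The coordinate at the first 1 of `v` is determined by the later ones; the coordinates before it
-- stay free and are handled by recursion.
hyperplane : (v : Vec 𝔽₂ (suc k)) → v ≢ 𝟎 → Hyperplane v
hyperplane (1ℙ ∷ w) _ = record
  { embed      = λ c → c ∙ w ∷ c
  ; additive   = λ c d → cong (_∷ (c ⊕ d)) (∙-distribʳ w c d)
  ; injective  = λ c eq → ∷-injectiveʳ eq
  ; orthogonal = λ c → trans (cong (_+₂ c ∙ w) (ℙ.*-identityʳ (c ∙ w))) (ℙ.p+p≡0ℙ (c ∙ w))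
  ; surjective = λ { (p ∷ d) eq → d , cong (_∷ d) (sym (p+q≡0⇒p≡q p (d ∙ w)
                     (trans (cong (_+₂ d ∙ w) (sym (ℙ.*-identityʳ p))) eq))) }
  ; outside    = 1ℙ ∷ 𝟎
  ; outside-∙  = cong (1ℙ +₂_) (∙-zeroˡ w)
  }
hyperplane {zero}  (0ℙ ∷ []) v≢𝟎 = ⊥-elim (v≢𝟎 refl)
hyperplane {suc k} (0ℙ ∷ w)  v≢𝟎 = record
  { embed      = λ { (p ∷ c) → p ∷ embed c }
  ; additive   = λ { (p ∷ c) (q ∷ d) → cong (p +₂ q ∷_) (additive c d) }
  ; injective  = λ { (p ∷ c) eq → cong₂ _∷_ (∷-injectiveˡ eq) (injective c (∷-injectiveʳ eq)) }
  ; orthogonal = λ { (p ∷ c) → trans (cong (_+₂ embed c ∙ w) (ℙ.*-zeroʳ p)) (orthogonal c) }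
  ; surjective = λ { (p ∷ d) eq →
                     let c , eq′ = surjective d (trans (cong (_+₂ d ∙ w) (sym (ℙ.*-zeroʳ p))) eq)
                     in p ∷ c , cong (p ∷_) eq′ }
  ; outside    = 0ℙ ∷ outside
  ; outside-∙  = outside-∙
  }
  where open Hyperplane (hyperplane w (v≢𝟎 ∘ cong (0ℙ ∷_)))

-- Odd weight and scattered vectors

-- Squares are trivial in `𝔽₂`. This turns odd weight into an inner product, which self-duality can
-- evaluate.
parity-weight : (a : Vec 𝔽₂ n) → parity (weight a) ≡ a ∙ a
parity-weight []       = refl
parity-weight (0ℙ ∷ a) = parity-weight a
parity-weight (1ℙ ∷ a) = trans (ℙ.+-homo-+ 1 (weight a)) (cong (1ℙ +₂_) (parity-weight a))

-- The entry function of scatter is local to its definition; unification recovers it.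
scatterEntries : (position : Fin k → Fin n) (a : Vec 𝔽₂ k) →
                 ∃[ entry ] scatter position a ≡ tabulate entry
scatterEntries position a = _ , refl

-- The only case split on the search inside `scatter`; the later facts about it go through this
-- eliminator.
lookup-scatter-elim : (position : Fin k → Fin n) (a : Vec 𝔽₂ k) (p : Fin n) (P : 𝔽₂ → Set) →
                      (∀ i → position i ≡ p → P (lookup a i)) →
                      ((∀ i → position i ≢ p) → P 0ℙ) →
                      P (lookup (scatter position a) p)
lookup-scatter-elim position a p P inside outside =
  subst P (sym (lookup∘tabulate _ p)) entry
  where
  entry : P (proj₁ (scatterEntries position a) p)
  entry with any? (λ i → position i ≟ᶠ p)
  ... | yes (i , eq) = inside i eq
  ... | no  ∄        = outside (λ i eq → ∄ (i , eq))

module _ {position : Fin k → Fin n}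
         (injective : ∀ {i j} → position i ≡ position j → i ≡ j) where

  lookup-scatter : (a : Vec 𝔽₂ k) (i : Fin k) → lookup (scatter position a) (position i) ≡ lookup a i
  lookup-scatter a i = lookup-scatter-elim position a (position i) (_≡ lookup a i)
    (λ j eq → cong (lookup a) (injective eq))
    (λ ∄ → ⊥-elim (∄ i refl))

  -- Makes matrix identities applicable to `scatter`. Injectivity ensures that at most one unit
  -- vector contributes to each coordinate.
  scatter-ᵛ*ᴹ : (a : Vec 𝔽₂ k) → scatter position a ≡ a ᵛ*ᴹ tabulate (unit ∘ position)
  scatter-ᵛ*ᴹ a = lookup-ext λ p → begin
    lookup (scatter position a) p
      ≡⟨ lookup-scatter-elim position a p (_≡ _) (inside p) (outside p) ⟩
    a ∙ tabulate (λ j → lookup (unit (position j)) p)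
      ≡⟨ cong (a ∙_) (tabulate-∘ (λ g → lookup g p) (unit ∘ position)) ⟩
    a ∙ map (λ g → lookup g p) (tabulate (unit ∘ position))
      ≡⟨ lookup-ᵛ*ᴹ a _ p ⟨
    lookup (a ᵛ*ᴹ tabulate (unit ∘ position)) p ∎
    where
    inside : ∀ p i → position i ≡ p → lookup a i ≡ a ∙ tabulate (λ j → lookup (unit (position j)) p)
    inside _ i refl = sym (begin
      a ∙ tabulate (λ j → lookup (unit (position j)) (position i))
        ≡⟨ cong (a ∙_) (tabulate-cong column) ⟩
      a ∙ tabulate (lookup (unit i))
        ≡⟨ cong (a ∙_) (tabulate∘lookup (unit i)) ⟩
      a ∙ unit i
        ≡⟨ ∙-comm a (unit i) ⟩
      unit i ∙ a
        ≡⟨ unit-∙ i a ⟩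
      lookup a i ∎)
      where
      column : ∀ j → lookup (unit (position j)) (position i) ≡ lookup (unit i) j
      column j with i ≟ᶠ j
      ... | yes refl = trans (lookup-unit (position i)) (sym (lookup-unit i))
      ... | no  i≢j  = trans (lookup-unit-≢ (i≢j ∘ sym ∘ injective)) (sym (lookup-unit-≢ i≢j))

    outside : ∀ p → (∀ i → position i ≢ p) →
              0ℙ ≡ a ∙ tabulate (λ j → lookup (unit (position j)) p)
    outside p ∄ = sym (trans (cong (a ∙_) (lookup-ext column)) (∙-zeroʳ a))
      where
      column : ∀ j → lookup (tabulate (λ i → lookup (unit (position i)) p)) j ≡ lookup 𝟎 j
      column j = trans (lookup∘tabulate _ j)
        (trans (lookup-unit-≢ (∄ j)) (sym (lookup-replicate j 0ℙ)))

  scatter-∙ : (a : Vec 𝔽₂ k) (x : Vec 𝔽₂ n) →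
              scatter position a ∙ x ≡ a ∙ tabulate (lookup x ∘ position)
  scatter-∙ a x = begin
    scatter position a ∙ x                            ≡⟨ cong (_∙ x) (scatter-ᵛ*ᴹ a) ⟩
    (a ᵛ*ᴹ tabulate (unit ∘ position)) ∙ x            ≡⟨ ᵛ*ᴹ-∙ a _ x ⟩
    a ∙ map (_∙ x) (tabulate (unit ∘ position))       ≡⟨ cong (a ∙_) (tabulate-∘ (_∙ x) _) ⟨
    a ∙ tabulate (λ i → unit (position i) ∙ x)        ≡⟨ cong (a ∙_) (tabulate-cong λ i → unit-∙ (position i) x) ⟩
    a ∙ tabulate (lookup x ∘ position)                ∎

  scatter-∙-scatter : (a : Vec 𝔽₂ k) → scatter position a ∙ scatter position a ≡ a ∙ a
  scatter-∙-scatter a = trans (scatter-∙ a _)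
    (cong (a ∙_) (trans (tabulate-cong (lookup-scatter a)) (tabulate∘lookup a)))

-- Coordinate permutations

lookup-permute : (σ : Permutation′ n) (x : Vec 𝔽₂ n) (i : Fin n) →
                 lookup (permute σ x) i ≡ lookup x (σ ⟨$⟩ˡ i)
lookup-permute σ x i = lookup∘tabulate _ i

-- Testing entries at `σ ⟨$⟩ʳ i` keeps the inverse permutation out of later goals.
permute-unique : (σ : Permutation′ n) (x : Vec 𝔽₂ n) {y : Vec 𝔽₂ n} →
                 (∀ i → lookup y (σ ⟨$⟩ʳ i) ≡ lookup x i) → permute σ x ≡ y
permute-unique σ x {y} eq = lookup-ext λ i → begin
  lookup (permute σ x) i             ≡⟨ lookup-permute σ x i ⟩
  lookup x (σ ⟨$⟩ˡ i)                ≡⟨ eq (σ ⟨$⟩ˡ i) ⟨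
  lookup y (σ ⟨$⟩ʳ (σ ⟨$⟩ˡ i))       ≡⟨ cong (lookup y) (inverseʳ σ) ⟩
  lookup y i                         ∎

permute-id : (x : Vec 𝔽₂ n) → permute Perm.id x ≡ x
permute-id = tabulate∘lookup

-- Note the order: `∘ₚ` applies its left factor first.
permute-∘ : (σ τ : Permutation′ n) (x : Vec 𝔽₂ n) → permute (σ ∘ₚ τ) x ≡ permute τ (permute σ x)
permute-∘ σ τ x = tabulate-cong λ i → sym (lookup-permute σ x (τ ⟨$⟩ˡ i))

permute-flipˡ : (σ : Permutation′ n) (x : Vec 𝔽₂ n) → permute (flip σ) (permute σ x) ≡ x
permute-flipˡ σ x = permute-unique (flip σ) (permute σ x) λ i → sym (lookup-permute σ x i)

permute-flipʳ : (σ : Permutation′ n) (x : Vec 𝔽₂ n) → permute σ (permute (flip σ) x) ≡ x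
permute-flipʳ σ x = permute-unique σ (permute (flip σ) x) λ i → sym (lookup-permute (flip σ) x i)

permute-additive : (σ : Permutation′ n) → Additive (permute σ)
permute-additive σ x y = lookup-ext λ i → begin
  lookup (permute σ (x ⊕ y)) i                        ≡⟨ lookup-permute σ (x ⊕ y) i ⟩
  lookup (x ⊕ y) (σ ⟨$⟩ˡ i)                           ≡⟨ lookup-zipWith _+₂_ (σ ⟨$⟩ˡ i) x y ⟩
  lookup x (σ ⟨$⟩ˡ i) +₂ lookup y (σ ⟨$⟩ˡ i)
    ≡⟨ cong₂ _+₂_ (lookup-permute σ x i) (lookup-permute σ y i) ⟨
  lookup (permute σ x) i +₂ lookup (permute σ y) i    ≡⟨ lookup-zipWith _+₂_ i (permute σ x) (permute σ y) ⟨
  lookup (permute σ x ⊕ permute σ y) i                ∎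

∙-sum : (x y : Vec 𝔽₂ n) → x ∙ y ≡ sum ℙ.+-0-commutativeMonoid (λ i → lookup x i *₂ lookup y i)
∙-sum []      []      = refl
∙-sum (p ∷ x) (q ∷ y) = cong (p *₂ q +₂_) (∙-sum x y)

-- A sum over all coordinates does not change under reindexing.
∙-permute : (σ : Permutation′ n) (x y : Vec 𝔽₂ n) → permute σ x ∙ permute σ y ≡ x ∙ y
∙-permute σ x y = begin
  permute σ x ∙ permute σ y
    ≡⟨ ∙-sum (permute σ x) (permute σ y) ⟩
  sum ℙ.+-0-commutativeMonoid (λ i → lookup (permute σ x) i *₂ lookup (permute σ y) i)
    ≡⟨ sum-cong-≗ ℙ.+-0-commutativeMonoid
         (λ i → cong₂ _*₂_ (lookup-permute σ x i) (lookup-permute σ y i)) ⟩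
  sum ℙ.+-0-commutativeMonoid (λ i → lookup x (σ ⟨$⟩ˡ i) *₂ lookup y (σ ⟨$⟩ˡ i))
    ≡⟨ sum-permute ℙ.+-0-commutativeMonoid (λ i → lookup x i *₂ lookup y i) (flip σ) ⟨
  sum ℙ.+-0-commutativeMonoid (λ i → lookup x i *₂ lookup y i)
    ≡⟨ ∙-sum x y ⟨
  x ∙ y ∎

-- Equivalences and permuted codes

-- An elementwise form of `Image σ C ≐ Codeword D`: as `permute σ` is invertible, reflecting
-- membership amounts to surjectivity onto `D`.
record Carries (σ : Permutation′ n) (C D : LinearCode n) : Set where
  field
    to   : ∀ {x} → x ∈ Codeword C → permute σ x ∈ Codeword D
    from : ∀ {x} → permute σ x ∈ Codeword D → x ∈ Codeword C

module _ {C D : LinearCode n} {σ : Permutation′ n} where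

  image⇒carries : Image σ C ≐ Codeword D → Carries σ C D
  image⇒carries (⊆ , ⊇) = record
    { to   = λ x∈C → ⊆ (_ , x∈C , refl)
    ; from = λ {x} σx∈D → let y , y∈C , eq = ⊇ σx∈D in
        subst (Codeword C) (trans (sym (permute-flipˡ σ y))
          (trans (cong (permute (flip σ)) eq) (permute-flipˡ σ x))) y∈C
    }

  carries⇒image : Carries σ C D → Image σ C ≐ Codeword D
  carries⇒image c =
    (λ (x , x∈C , eq) → subst (Codeword D) eq (to x∈C))
    , λ {y} y∈D → permute (flip σ) y
                  , from (subst (Codeword D) (sym (permute-flipʳ σ y)) y∈D)
                  , permute-flipʳ σ y
    where open Carries c

  carries-flip : Carries σ C D → Carries (flip σ) D C
  carries-flip c = record
    { to   = λ {x} x∈D → from (subst (Codeword D) (sym (permute-flipʳ σ x)) x∈D)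
    ; from = λ {x} σx∈C → subst (Codeword D) (permute-flipʳ σ x) (to σx∈C)
    }
    where open Carries c

carries-id : {C D : LinearCode n} → Codeword C ≐ Codeword D → Carries Perm.id C D
carries-id {C = C} {D} (⊆ , ⊇) = record
  { to   = λ {x} x∈C → subst (Codeword D) (sym (permute-id x)) (⊆ x∈C)
  ; from = λ {x} x∈D → ⊇ (subst (Codeword D) (permute-id x) x∈D)
  }

carries-∘ : {C D E : LinearCode n} {σ τ : Permutation′ n} →
            Carries σ C D → Carries τ D E → Carries (σ ∘ₚ τ) C E
carries-∘ {E = E} {σ} {τ} c d = record
  { to   = λ {x} x∈C → subst (Codeword E) (sym (permute-∘ σ τ x)) (D.to (C.to x∈C))
  ; from = λ {x} x∈E → C.from (D.from (subst (Codeword E) (permute-∘ σ τ x) x∈E))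
  }
  where
  module C = Carries c
  module D = Carries d

carries-≐ʳ : {C D E : LinearCode n} {σ : Permutation′ n} →
             Carries σ C D → Codeword D ≐ Codeword E → Carries σ C E
carries-≐ʳ c (⊆ , ⊇) = record { to = ⊆ ∘ to ; from = from ∘ ⊇ }
  where open Carries c

≅⇒carries : {X Y : Ω k} → X ≅ Y → ∃[ σ ] Carries σ (code X) (code Y)
≅⇒carries {X = X} {Y} (σ , eq) = σ , image⇒carries {C = code X} {code Y} {σ} eq

carries⇒≅ : {X Y : Ω k} {σ : Permutation′ (k * 2)} → Carries σ (code X) (code Y) → X ≅ Y
carries⇒≅ {X = X} {Y} {σ} c = σ , carries⇒image {C = code X} {code Y} {σ} c

≅-refl : (X : Ω k) → X ≅ X
≅-refl X = carries⇒≅ {X = X} {X} (carries-id (id , id))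

≅-sym : {X Y : Ω k} → X ≅ Y → Y ≅ X
≅-sym {X = X} {Y} X≅Y = carries⇒≅ {X = Y} {X} (carries-flip (proj₂ (≅⇒carries {X = X} {Y} X≅Y)))

≅-trans : {X Y Z : Ω k} → X ≅ Y → Y ≅ Z → X ≅ Z
≅-trans {X = X} {Y} {Z} X≅Y Y≅Z = carries⇒≅ {X = X} {Z}
  (carries-∘ (proj₂ (≅⇒carries {X = X} {Y} X≅Y)) (proj₂ (≅⇒carries {X = Y} {Z} Y≅Z)))

-- Using the preimage under the inverse, rather than the image, keeps membership free of existential
-- witnesses.
permuteCode : Permutation′ n → LinearCode n → LinearCode n
permuteCode σ C = record
  { Codeword = λ x → permute (flip σ) x ∈ Codeword C
  ; 𝟎∈       = subst (Codeword C) (sym (additive-𝟎 (permute-additive (flip σ)))) (LinearCode.𝟎∈ C)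
  ; ⊕-closed = λ {x} {y} x∈ y∈ →
      subst (Codeword C) (sym (permute-additive (flip σ) x y)) (LinearCode.⊕-closed C x∈ y∈)
  }

carries-permuteCode : (σ : Permutation′ n) (C : LinearCode n) → Carries σ C (permuteCode σ C)
carries-permuteCode σ C = record
  { to   = λ {x} x∈C → subst (Codeword C) (sym (permute-flipˡ σ x)) x∈C
  ; from = λ {x} x∈C → subst (Codeword C) (permute-flipˡ σ x) x∈C
  }

-- Duality survives because permutations preserve inner products, and dimension because they are
-- additive and injective.
permuteΩ : Permutation′ (k * 2) → Ω k → Ω k
permuteΩ σ X = record
  { code      = D
  ; selfDual  =
      (λ {y} y∈D x x∈D → trans (sym (∙-permute (flip σ) x y))
                          (proj₁ (Ω.selfDual X) y∈D (permute (flip σ) x) x∈D))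
      , λ {y} y∈D⊥ → proj₂ (Ω.selfDual X) λ x x∈C → begin
          x ∙ permute (flip σ) y
            ≡⟨ ∙-permute σ x (permute (flip σ) y) ⟨
          permute σ x ∙ permute σ (permute (flip σ) y)
            ≡⟨ cong (permute σ x ∙_) (permute-flipʳ σ y) ⟩
          permute σ x ∙ y
            ≡⟨ y∈D⊥ (permute σ x) (Carries.to (carries-permuteCode σ C) x∈C) ⟩
          0ℙ ∎
  ; dimension = let G , (⊆ , ⊇) , independent = Ω.dimension X in
      hasDimension D (λ c → permute σ (c ᵛ*ᴹ G))
        (λ c d → trans (cong (permute σ) (ᵛ*ᴹ-distribʳ c d G))
                       (permute-additive σ (c ᵛ*ᴹ G) (d ᵛ*ᴹ G)))
        (λ c eq → independent c (trans (sym (permute-flipˡ σ (c ᵛ*ᴹ G)))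
          (trans (cong (permute (flip σ)) eq) (additive-𝟎 (permute-additive (flip σ))))))
        (λ c → Carries.to (carries-permuteCode σ C) (⊇ (c , refl)))
        (λ {y} y∈D → let c , eq = ⊆ y∈D in
          c , trans (cong (permute σ) eq) (permute-flipʳ σ y))
  }
  where
  C = code X
  D = permuteCode σ C

-- The last two coordinates

snoc² : (u : Vec 𝔽₂ (2 +ℕ n)) → ∃[ x ] ∃[ s ] ∃[ t ] u ≡ x ∷ʳ s ∷ʳ t
snoc² u with initLast u
... | v , t , refl with initLast v
...   | x , s , refl = x , s , t , refl

lookup-∷ʳ-fromℕ : (x : Vec 𝔽₂ n) (p : 𝔽₂) → lookup (x ∷ʳ p) (fromℕ n) ≡ p
lookup-∷ʳ-fromℕ []      p = refl
lookup-∷ʳ-fromℕ (_ ∷ x) p = lookup-∷ʳ-fromℕ x p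

lookup-∷ʳ-inject₁ : (x : Vec 𝔽₂ n) (p : 𝔽₂) (i : Fin n) → lookup (x ∷ʳ p) (inject₁ i) ≡ lookup x i
lookup-∷ʳ-inject₁ (_ ∷ x) p zero    = refl
lookup-∷ʳ-inject₁ (_ ∷ x) p (suc i) = lookup-∷ʳ-inject₁ x p i

lookup-last : (x : Vec 𝔽₂ n) (s t : 𝔽₂) → lookup (x ∷ʳ s ∷ʳ t) last ≡ t
lookup-last x s t = lookup-∷ʳ-fromℕ (x ∷ʳ s) t

lookup-penultimate : (x : Vec 𝔽₂ n) (s t : 𝔽₂) → lookup (x ∷ʳ s ∷ʳ t) penultimate ≡ s
lookup-penultimate x s t =
  trans (lookup-∷ʳ-inject₁ (x ∷ʳ s) t (fromℕ _)) (lookup-∷ʳ-fromℕ x s)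

punchIn-fromℕ : (i : Fin n) → punchIn (fromℕ n) i ≡ inject₁ i
punchIn-fromℕ zero    = refl
punchIn-fromℕ (suc i) = cong suc (punchIn-fromℕ i)

insert-self : ∀ (i j : Fin (suc n)) (σ : Permutation′ n) → Perm.insert i j σ ⟨$⟩ʳ i ≡ j
insert-self i j σ with i ≟ᶠ i
... | yes _   = refl
... | no  i≢i = ⊥-elim (i≢i refl)

permute-∷ʳ : (τ : Permutation′ (suc n)) (σ : Permutation′ n) → τ ⟨$⟩ʳ fromℕ n ≡ fromℕ n →
             (∀ i → τ ⟨$⟩ʳ inject₁ i ≡ inject₁ (σ ⟨$⟩ʳ i)) →
             ∀ x p → permute τ (x ∷ʳ p) ≡ permute σ x ∷ʳ p
permute-∷ʳ τ σ τ-last τ-inject₁ x p = permute-unique τ (x ∷ʳ p) entry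
  where
  entry : ∀ i → lookup (permute σ x ∷ʳ p) (τ ⟨$⟩ʳ i) ≡ lookup (x ∷ʳ p) i
  entry i with view i
  ... | ‵fromℕ     = begin
    lookup (permute σ x ∷ʳ p) (τ ⟨$⟩ʳ fromℕ _)  ≡⟨ cong (lookup (permute σ x ∷ʳ p)) τ-last ⟩
    lookup (permute σ x ∷ʳ p) (fromℕ _)         ≡⟨ lookup-∷ʳ-fromℕ (permute σ x) p ⟩
    p                                           ≡⟨ lookup-∷ʳ-fromℕ x p ⟨
    lookup (x ∷ʳ p) (fromℕ _)                   ∎
  ... | ‵inject₁ j = begin
    lookup (permute σ x ∷ʳ p) (τ ⟨$⟩ʳ inject₁ j)    ≡⟨ cong (lookup (permute σ x ∷ʳ p)) (τ-inject₁ j) ⟩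
    lookup (permute σ x ∷ʳ p) (inject₁ (σ ⟨$⟩ʳ j))  ≡⟨ lookup-∷ʳ-inject₁ (permute σ x) p (σ ⟨$⟩ʳ j) ⟩
    lookup (permute σ x) (σ ⟨$⟩ʳ j)                 ≡⟨ lookup-permute σ x (σ ⟨$⟩ʳ j) ⟩
    lookup x (σ ⟨$⟩ˡ (σ ⟨$⟩ʳ j))                    ≡⟨ cong (lookup x) (inverseˡ σ) ⟩
    lookup x j                                      ≡⟨ lookup-∷ʳ-inject₁ x p j ⟨
    lookup (x ∷ʳ p) (inject₁ j)                     ∎

-- Extending and restricting permutations

extend : Permutation′ n → Permutation′ (suc n)
extend = Perm.insert (fromℕ _) (fromℕ _)

extend-fromℕ : (σ : Permutation′ n) → extend σ ⟨$⟩ʳ fromℕ n ≡ fromℕ n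
extend-fromℕ σ = insert-self (fromℕ _) (fromℕ _) σ

extend-inject₁ : (σ : Permutation′ n) (i : Fin n) → extend σ ⟨$⟩ʳ inject₁ i ≡ inject₁ (σ ⟨$⟩ʳ i)
extend-inject₁ σ i = begin
  extend σ ⟨$⟩ʳ inject₁ i             ≡⟨ cong (extend σ ⟨$⟩ʳ_) (punchIn-fromℕ i) ⟨
  extend σ ⟨$⟩ʳ punchIn (fromℕ _) i   ≡⟨ Perm.insert-punchIn (fromℕ _) (fromℕ _) σ i ⟩
  punchIn (fromℕ _) (σ ⟨$⟩ʳ i)        ≡⟨ punchIn-fromℕ (σ ⟨$⟩ʳ i) ⟩
  inject₁ (σ ⟨$⟩ʳ i)                  ∎

permute-extend : (σ : Permutation′ n) (x : Vec 𝔽₂ n) (p : 𝔽₂) →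
                 permute (extend σ) (x ∷ʳ p) ≡ permute σ x ∷ʳ p
permute-extend σ = permute-∷ʳ (extend σ) σ (extend-fromℕ σ) (extend-inject₁ σ)

extend² : Permutation′ n → Permutation′ (2 +ℕ n)
extend² σ = extend (extend σ)

permute-extend² : (σ : Permutation′ n) (x : Vec 𝔽₂ n) (s t : 𝔽₂) →
                  permute (extend² σ) (x ∷ʳ s ∷ʳ t) ≡ permute σ x ∷ʳ s ∷ʳ t
permute-extend² σ x s t =
  trans (permute-extend (extend σ) (x ∷ʳ s) t) (cong (_∷ʳ t) (permute-extend σ x s))

-- In general `remove` skips the deleted point and its image; here both are the last point, and
-- skipping that is `inject₁`.
remove-inject₁ : (τ : Permutation′ (suc n)) → τ ⟨$⟩ʳ fromℕ n ≡ fromℕ n →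
                 ∀ i → τ ⟨$⟩ʳ inject₁ i ≡ inject₁ (Perm.remove (fromℕ n) τ ⟨$⟩ʳ i)
remove-inject₁ {n} τ τ-last i = begin
  τ ⟨$⟩ʳ inject₁ i                    ≡⟨ cong (τ ⟨$⟩ʳ_) (punchIn-fromℕ i) ⟨
  τ ⟨$⟩ʳ punchIn (fromℕ n) i          ≡⟨ Perm.punchIn-permute τ (fromℕ n) i ⟩
  punchIn (τ ⟨$⟩ʳ fromℕ n) (σ ⟨$⟩ʳ i)  ≡⟨ cong (λ l → punchIn l (σ ⟨$⟩ʳ i)) τ-last ⟩
  punchIn (fromℕ n) (σ ⟨$⟩ʳ i)        ≡⟨ punchIn-fromℕ (σ ⟨$⟩ʳ i) ⟩
  inject₁ (σ ⟨$⟩ʳ i)                  ∎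
  where σ = Perm.remove (fromℕ n) τ

transpose-ˡ : (i j : Fin n) → Perm.transpose i j ⟨$⟩ʳ i ≡ j
transpose-ˡ i j with i ≟ᶠ i
... | yes _   = refl
... | no  i≢i = ⊥-elim (i≢i refl)

transpose-ʳ : (i j : Fin n) → Perm.transpose i j ⟨$⟩ʳ j ≡ i
transpose-ʳ i j with j ≟ᶠ i
... | yes j≡i = j≡i
... | no  _ with j ≟ᶠ j
...   | yes _   = refl
...   | no  j≢j = ⊥-elim (j≢j refl)

transpose-≢ : {i j k : Fin n} → k ≢ i → k ≢ j → Perm.transpose i j ⟨$⟩ʳ k ≡ k
transpose-≢ {i = i} {j} {k} k≢i k≢j with k ≟ᶠ i
... | yes k≡i = ⊥-elim (k≢i k≡i)
... | no  _ with k ≟ᶠ j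
...   | yes k≡j = ⊥-elim (k≢j k≡j)
...   | no  _   = refl

swapLast : Permutation′ (2 +ℕ n)
swapLast = Perm.transpose penultimate last

permute-swapLast : (x : Vec 𝔽₂ n) (s t : 𝔽₂) →
                   permute swapLast (x ∷ʳ s ∷ʳ t) ≡ x ∷ʳ t ∷ʳ s
permute-swapLast {n} x s t = permute-unique swapLast (x ∷ʳ s ∷ʳ t) entry
  where
  entry : ∀ i → lookup (x ∷ʳ t ∷ʳ s) (swapLast ⟨$⟩ʳ i) ≡ lookup (x ∷ʳ s ∷ʳ t) i
  entry i with view i
  ... | ‵fromℕ = begin
    lookup (x ∷ʳ t ∷ʳ s) (swapLast ⟨$⟩ʳ last)
      ≡⟨ cong (lookup (x ∷ʳ t ∷ʳ s)) (transpose-ʳ (penultimate {n}) last) ⟩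
    lookup (x ∷ʳ t ∷ʳ s) penultimate
      ≡⟨ lookup-penultimate x t s ⟩
    t
      ≡⟨ lookup-last x s t ⟨
    lookup (x ∷ʳ s ∷ʳ t) last ∎
  ... | ‵inject₁ j with view j
  ...   | ‵fromℕ = begin
    lookup (x ∷ʳ t ∷ʳ s) (swapLast ⟨$⟩ʳ penultimate)
      ≡⟨ cong (lookup (x ∷ʳ t ∷ʳ s)) (transpose-ˡ (penultimate {n}) last) ⟩
    lookup (x ∷ʳ t ∷ʳ s) last
      ≡⟨ lookup-last x t s ⟩
    s
      ≡⟨ lookup-penultimate x s t ⟨
    lookup (x ∷ʳ s ∷ʳ t) penultimate ∎
  ...   | ‵inject₁ l = begin
    lookup (x ∷ʳ t ∷ʳ s) (swapLast ⟨$⟩ʳ inject₁ (inject₁ l))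
      ≡⟨ cong (lookup (x ∷ʳ t ∷ʳ s)) (transpose-≢
           (λ eq → fromℕ≢inject₁ (sym (inject₁-injective eq))) (fromℕ≢inject₁ ∘ sym)) ⟩
    lookup (x ∷ʳ t ∷ʳ s) (inject₁ (inject₁ l))
      ≡⟨ lookup-inner t s ⟩
    lookup x l
      ≡⟨ lookup-inner s t ⟨
    lookup (x ∷ʳ s ∷ʳ t) (inject₁ (inject₁ l)) ∎
    where
    lookup-inner : ∀ s t → lookup (x ∷ʳ s ∷ʳ t) (inject₁ (inject₁ l)) ≡ lookup x l
    lookup-inner s t = trans (lookup-∷ʳ-inject₁ (x ∷ʳ s) t (inject₁ l)) (lookup-∷ʳ-inject₁ x s l)

FixesLastTwo SwapsLastTwo PreservesLastTwo : Permutation′ (2 +ℕ n) → Set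
FixesLastTwo τ     = τ ⟨$⟩ʳ penultimate ≡ penultimate × τ ⟨$⟩ʳ last ≡ last
SwapsLastTwo τ     = τ ⟨$⟩ʳ penultimate ≡ last × τ ⟨$⟩ʳ last ≡ penultimate
PreservesLastTwo τ = FixesLastTwo τ ⊎ SwapsLastTwo τ

preserves-∘ : (σ τ : Permutation′ (2 +ℕ n)) →
              PreservesLastTwo σ → PreservesLastTwo τ → PreservesLastTwo (σ ∘ₚ τ)
preserves-∘ σ τ (inj₁ (p , l)) (inj₁ (p′ , l′)) =
  inj₁ (trans (cong (τ ⟨$⟩ʳ_) p) p′ , trans (cong (τ ⟨$⟩ʳ_) l) l′)
preserves-∘ σ τ (inj₁ (p , l)) (inj₂ (p′ , l′)) =
  inj₂ (trans (cong (τ ⟨$⟩ʳ_) p) p′ , trans (cong (τ ⟨$⟩ʳ_) l) l′)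
preserves-∘ σ τ (inj₂ (p , l)) (inj₁ (p′ , l′)) =
  inj₂ (trans (cong (τ ⟨$⟩ʳ_) p) l′ , trans (cong (τ ⟨$⟩ʳ_) l) p′)
preserves-∘ σ τ (inj₂ (p , l)) (inj₂ (p′ , l′)) =
  inj₁ (trans (cong (τ ⟨$⟩ʳ_) p) l′ , trans (cong (τ ⟨$⟩ʳ_) l) p′)

preserves-flip : (σ : Permutation′ (2 +ℕ n)) → PreservesLastTwo σ → PreservesLastTwo (flip σ)
preserves-flip σ (inj₁ (p , l)) = inj₁ (invert p , invert l)
  where
  invert : ∀ {i j} → σ ⟨$⟩ʳ i ≡ j → σ ⟨$⟩ˡ j ≡ i
  invert refl = inverseˡ σ
preserves-flip σ (inj₂ (p , l)) = inj₂ (invert l , invert p)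
  where
  invert : ∀ {i j} → σ ⟨$⟩ʳ i ≡ j → σ ⟨$⟩ˡ j ≡ i
  invert refl = inverseˡ σ

extend²-fixes : (σ : Permutation′ n) → FixesLastTwo (extend² σ)
extend²-fixes σ =
  trans (extend-inject₁ (extend σ) (fromℕ _)) (cong inject₁ (extend-fromℕ σ))
  , extend-fromℕ (extend σ)

swapLast-swaps : SwapsLastTwo (swapLast {n})
swapLast-swaps {n} = transpose-ˡ (penultimate {n}) last , transpose-ʳ (penultimate {n}) last

-- Only words with equal last two entries are tested, so τ may swap these coordinates.
Restricts : Permutation′ (2 +ℕ n) → Permutation′ n → Set
Restricts τ σ = ∀ x t → permute τ (x ∷ʳ t ∷ʳ t) ≡ permute σ x ∷ʳ t ∷ʳ t

restrict-fixing : (τ : Permutation′ (2 +ℕ n)) → FixesLastTwo τ → ∃[ σ ] Restricts τ σ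
restrict-fixing {n} τ (τ-penultimate , τ-last) = τ₂ , λ x t → begin
  permute τ (x ∷ʳ t ∷ʳ t)       ≡⟨ permute-∷ʳ τ τ₁ τ-last (remove-inject₁ τ τ-last) (x ∷ʳ t) t ⟩
  permute τ₁ (x ∷ʳ t) ∷ʳ t      ≡⟨ cong (_∷ʳ t) (permute-∷ʳ τ₁ τ₂ τ₁-last (remove-inject₁ τ₁ τ₁-last) x t) ⟩
  permute τ₂ x ∷ʳ t ∷ʳ t        ∎
  where
  τ₁ = Perm.remove (fromℕ (suc n)) τ
  τ₂ = Perm.remove (fromℕ n) τ₁
  τ₁-last : τ₁ ⟨$⟩ʳ fromℕ n ≡ fromℕ n
  τ₁-last = inject₁-injective (trans (sym (remove-inject₁ τ τ-last (fromℕ n))) τ-penultimate)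

-- If `τ` swaps the ends, composing with `swapLast` makes it fix them, and `swapLast` does not move
-- a word with equal ends.
restrict : (τ : Permutation′ (2 +ℕ n)) → PreservesLastTwo τ → ∃[ σ ] Restricts τ σ
restrict τ (inj₁ fixes) = restrict-fixing τ fixes
restrict {n} τ (inj₂ (τ-penultimate , τ-last)) = σ , λ x t → begin
  permute τ (x ∷ʳ t ∷ʳ t)
    ≡⟨ permute-flipˡ swapLast _ ⟨
  permute (flip swapLast) (permute swapLast (permute τ (x ∷ʳ t ∷ʳ t)))
    ≡⟨ cong (permute (flip swapLast)) (permute-∘ τ swapLast (x ∷ʳ t ∷ʳ t)) ⟨
  permute (flip swapLast) (permute (τ ∘ₚ swapLast) (x ∷ʳ t ∷ʳ t))
    ≡⟨ cong (permute (flip swapLast)) (restricts x t) ⟩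
  permute (flip swapLast) (permute σ x ∷ʳ t ∷ʳ t)
    ≡⟨ cong (permute (flip swapLast)) (permute-swapLast (permute σ x) t t) ⟨
  permute (flip swapLast) (permute swapLast (permute σ x ∷ʳ t ∷ʳ t))
    ≡⟨ permute-flipˡ swapLast _ ⟩
  permute σ x ∷ʳ t ∷ʳ t ∎
  where
  restriction : ∃[ σ ] Restricts (τ ∘ₚ swapLast) σ
  restriction = restrict-fixing (τ ∘ₚ swapLast)
    ( trans (cong (swapLast ⟨$⟩ʳ_) τ-penultimate) (proj₂ (swapLast-swaps {n}))
    , trans (cong (swapLast ⟨$⟩ʳ_) τ-last) (proj₁ (swapLast-swaps {n})))
  σ = proj₁ restriction
  restricts = proj₂ restriction

-- Parents and children

∷ʳ²-injective : {x y : Vec 𝔽₂ n} {p q s t : 𝔽₂} → x ∷ʳ p ∷ʳ q ≡ y ∷ʳ s ∷ʳ t → x ≡ y × p ≡ s × q ≡ t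
∷ʳ²-injective {x = x} {y} {p} {q} {s} {t} eq =
  let eq′ , q≡t = ∷ʳ-injective (x ∷ʳ p) (y ∷ʳ s) eq
      x≡y , p≡s = ∷ʳ-injective x y eq′
  in x≡y , p≡s , q≡t

⊕-∷ʳ² : (x y : Vec 𝔽₂ n) (p q s t : 𝔽₂) →
        (x ∷ʳ p ∷ʳ q) ⊕ (y ∷ʳ s ∷ʳ t) ≡ (x ⊕ y) ∷ʳ (p +₂ s) ∷ʳ (q +₂ t)
⊕-∷ʳ² x y p q s t = trans (⊕-∷ʳ (x ∷ʳ p) (y ∷ʳ s) q t) (cong (_∷ʳ (q +₂ t)) (⊕-∷ʳ x y p s))

∙-∷ʳ² : (x y : Vec 𝔽₂ n) (p q s t : 𝔽₂) →
        (x ∷ʳ p ∷ʳ q) ∙ (y ∷ʳ s ∷ʳ t) ≡ x ∙ y +₂ p *₂ s +₂ q *₂ t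
∙-∷ʳ² x y p q s t = trans (∙-∷ʳ (x ∷ʳ p) (y ∷ʳ s) q t) (cong (_+₂ q *₂ t) (∙-∷ʳ x y p s))

-- Pairing with this word adds the last two entries. Hence a self-dual code contains it exactly when
-- its last two coordinates are equal.
lastTwo : Vec 𝔽₂ (2 +ℕ n)
lastTwo = 𝟎 ∷ʳ 1ℙ ∷ʳ 1ℙ

∙-lastTwo : (x : Vec 𝔽₂ n) (p q : 𝔽₂) → (x ∷ʳ p ∷ʳ q) ∙ lastTwo ≡ p +₂ q
∙-lastTwo x p q = begin
  (x ∷ʳ p ∷ʳ q) ∙ lastTwo            ≡⟨ ∙-∷ʳ² x 𝟎 p q 1ℙ 1ℙ ⟩
  x ∙ 𝟎 +₂ p *₂ 1ℙ +₂ q *₂ 1ℙ        ≡⟨ cong₂ (λ r s → r +₂ s +₂ q *₂ 1ℙ) (∙-zeroʳ x) (ℙ.*-identityʳ p) ⟩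
  p +₂ q *₂ 1ℙ                       ≡⟨ cong (p +₂_) (ℙ.*-identityʳ q) ⟩
  p +₂ q                             ∎

-- A is obtained from C by keeping the codewords with equal last two entries
-- and deleting these entries.
record IsParent (A : LinearCode n) (C : LinearCode (2 +ℕ n)) : Set where
  field
    puncture  : ∀ {x t} → x ∷ʳ t ∷ʳ t ∈ Codeword C → x ∈ Codeword A
    lift      : ∀ {x} → x ∈ Codeword A → ∃[ t ] x ∷ʳ t ∷ʳ t ∈ Codeword C
    separated : ¬ (lastTwo ∈ Codeword C)

separated⇒≡0 : (C : LinearCode (2 +ℕ n)) → ¬ (lastTwo ∈ Codeword C) →
               ∀ t → 𝟎 ∷ʳ t ∷ʳ t ∈ Codeword C → t ≡ 0ℙ
separated⇒≡0 C separated 0ℙ _   = refl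
separated⇒≡0 C separated 1ℙ w∈C = ⊥-elim (separated w∈C)

-- The sum of two lifts of the same word is either zero or `lastTwo`, and the latter is excluded.
lift-unique : {A : LinearCode n} {C : LinearCode (2 +ℕ n)} → IsParent A C → ∀ {x s t} →
              x ∷ʳ s ∷ʳ s ∈ Codeword C → x ∷ʳ t ∷ʳ t ∈ Codeword C → s ≡ t
lift-unique {C = C} P {x} {s} {t} xs∈C xt∈C = p+q≡0⇒p≡q s t
  (separated⇒≡0 C (IsParent.separated P) (s +₂ t)
    (subst (Codeword C) eq (LinearCode.⊕-closed C xs∈C xt∈C)))
  where
  eq : (x ∷ʳ s ∷ʳ s) ⊕ (x ∷ʳ t ∷ʳ t) ≡ 𝟎 ∷ʳ (s +₂ t) ∷ʳ (s +₂ t)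
  eq = trans (⊕-∷ʳ² x x s s t t) (cong (λ y → y ∷ʳ (s +₂ t) ∷ʳ (s +₂ t)) (⊕-self x))

-- If `lastTwo` were a codeword, it would be orthogonal to all codewords, and each would have equal
-- ends.
unequal⇒separated : (C : LinearCode (2 +ℕ n)) → Codeword C ≐ Dual C →
                    ¬ EqualCoordinates C penultimate last → ¬ (lastTwo ∈ Codeword C)
unequal⇒separated C (⊆ , _) unequal w∈C = unequal λ u u∈C → equal u (⊆ w∈C u u∈C)
  where
  equal : ∀ u → u ∙ lastTwo ≡ 0ℙ → lookup u penultimate ≡ lookup u last
  equal u u∙w≡0 with snoc² u
  ... | x , p , q , refl = begin
    lookup (x ∷ʳ p ∷ʳ q) penultimate  ≡⟨ lookup-penultimate x p q ⟩
    p                                 ≡⟨ p+q≡0⇒p≡q p q (trans (sym (∙-lastTwo x p q)) u∙w≡0) ⟩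
    q                                 ≡⟨ lookup-last x p q ⟨
    lookup (x ∷ʳ p ∷ʳ q) last         ∎

-- The words with equal ends form a subcode of index 2, and the given word represents the other
-- coset. Here `⁻¹` is the complement of a bit, so `q ⁻¹` and `q` are unequal ends.
split-ends : (C : LinearCode (2 +ℕ n)) → ∀ {z q u} →
             z ∷ʳ q ⁻¹ ∷ʳ q ∈ Codeword C → u ∈ Codeword C →
             ∃[ x ] ∃[ t ] x ∷ʳ t ∷ʳ t ∈ Codeword C ×
               (u ≡ x ∷ʳ t ∷ʳ t ⊎ u ≡ (z ∷ʳ q ⁻¹ ∷ʳ q) ⊕ (x ∷ʳ t ∷ʳ t))
split-ends C {z} {q} {u} z∈C u∈C with snoc² u
... | x , s , t , refl with s ℙ.≟ t
...   | yes refl = x , s , u∈C , inj₁ refl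
...   | no  s≢t  =
  z ⊕ x , q +₂ t
  , subst (Codeword C) sum≡ (LinearCode.⊕-closed C z∈C u∈C)
  , inj₂ (trans (sym (⊕-cancel v (x ∷ʳ s ∷ʳ t))) (cong (v ⊕_) sum≡))
  where
  v = z ∷ʳ q ⁻¹ ∷ʳ q
  ends : ∀ q s t → s ≢ t → q ⁻¹ +₂ s ≡ q +₂ t
  ends q  0ℙ 0ℙ s≢t = ⊥-elim (s≢t refl)
  ends 0ℙ 0ℙ 1ℙ s≢t = refl
  ends 1ℙ 0ℙ 1ℙ s≢t = refl
  ends 0ℙ 1ℙ 0ℙ s≢t = refl
  ends 1ℙ 1ℙ 0ℙ s≢t = refl
  ends q  1ℙ 1ℙ s≢t = ⊥-elim (s≢t refl)
  sum≡ : v ⊕ (x ∷ʳ s ∷ʳ t) ≡ (z ⊕ x) ∷ʳ (q +₂ t) ∷ʳ (q +₂ t)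
  sum≡ = trans (⊕-∷ʳ² z x (q ⁻¹) q s t)
               (cong (λ p → (z ⊕ x) ∷ʳ p ∷ʳ (q +₂ t)) (ends q s t s≢t))

-- Lift a word to the longer code, move it by `τ`, and delete the two ends again.
carries-parent : {A B : LinearCode n} {C D : LinearCode (2 +ℕ n)} →
                 IsParent A C → IsParent B D →
                 {τ : Permutation′ (2 +ℕ n)} {σ : Permutation′ n} →
                 Carries τ C D → Restricts τ σ → Carries σ A B
carries-parent {C = C} {D} P Q c restricts = record
  { to   = λ {x} x∈A → let t , xt∈C = P.lift x∈A in
             Q.puncture (subst (Codeword D) (restricts x t) (to xt∈C))
  ; from = λ {x} σx∈B → let t , σxt∈D = Q.lift σx∈B in
             P.puncture (from (subst (Codeword D) (sym (restricts x t)) σxt∈D))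
  }
  where
  module P = IsParent P
  module Q = IsParent Q
  open Carries c

-- Moving a code and its parent by compatible permutations preserves the relation; `separated`
-- survives because `τ` fixes `lastTwo`.
transport-parent : {A B : LinearCode n} {C D : LinearCode (2 +ℕ n)} →
                   {τ : Permutation′ (2 +ℕ n)} {σ : Permutation′ n} →
                   IsParent A C → Carries τ C D → Restricts τ σ → Carries σ A B → IsParent B D
transport-parent {B = B} {C} {D} {τ} {σ} P c restricts d = record
  { puncture  = λ {y} {t} yt∈D → subst (Codeword B) (permute-flipʳ σ y)
      (d.to (P.puncture (c.from {permute (flip σ) y ∷ʳ t ∷ʳ t}
        (subst (Codeword D) (sym (restrict-flip y t)) yt∈D))))
  ; lift      = λ {y} y∈B →
      let t , xt∈C = P.lift (d.from {permute (flip σ) y}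
                              (subst (Codeword B) (sym (permute-flipʳ σ y)) y∈B))
      in t , subst (Codeword D) (restrict-flip y t) (c.to xt∈C)
  ; separated = λ w∈D → P.separated (c.from (subst (Codeword D) (sym fixes) w∈D))
  }
  where
  module P = IsParent P
  module c = Carries c
  module d = Carries d
  restrict-flip : ∀ y t → permute τ (permute (flip σ) y ∷ʳ t ∷ʳ t) ≡ y ∷ʳ t ∷ʳ t
  restrict-flip y t =
    trans (restricts (permute (flip σ) y) t) (cong (λ x → x ∷ʳ t ∷ʳ t) (permute-flipʳ σ y))
  fixes : permute τ lastTwo ≡ lastTwo
  fixes = trans (restricts 𝟎 1ℙ) (cong (λ x → x ∷ʳ 1ℙ ∷ʳ 1ℙ) (additive-𝟎 (permute-additive σ)))

ᵛ*ᴹ-closed : (C : LinearCode n) (M : Matrix m n) → (∀ i → lookup M i ∈ Codeword C) →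
             ∀ c → c ᵛ*ᴹ M ∈ Codeword C
ᵛ*ᴹ-closed C []      rows []       = LinearCode.𝟎∈ C
ᵛ*ᴹ-closed C (g ∷ M) rows (0ℙ ∷ c) = subst (Codeword C)
  (trans (sym (⊕-identityˡ (c ᵛ*ᴹ M))) (cong (_⊕ c ᵛ*ᴹ M) (sym (scale-0 g))))
  (ᵛ*ᴹ-closed C M (rows ∘ suc) c)
ᵛ*ᴹ-closed C (g ∷ M) rows (1ℙ ∷ c) = subst (Codeword C)
  (cong (_⊕ c ᵛ*ᴹ M) (sym (scale-1 g)))
  (LinearCode.⊕-closed C (rows zero) (ᵛ*ᴹ-closed C M (rows ∘ suc) c))

ᵛ*ᴹ-extended : (c : Vec 𝔽₂ m) (G : Matrix m n) (a : Vec 𝔽₂ m) →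
               c ᵛ*ᴹ zipWith (λ g aᵢ → g ∷ʳ aᵢ ∷ʳ aᵢ) G a ≡ c ᵛ*ᴹ G ∷ʳ c ∙ a ∷ʳ c ∙ a
ᵛ*ᴹ-extended {n = n} [] [] [] = sym (trans (cong (_∷ʳ 0ℙ) (𝟎-∷ʳ n)) (𝟎-∷ʳ (suc n)))
ᵛ*ᴹ-extended (p ∷ c) (g ∷ G) (q ∷ a) = begin
  map (p *₂_) (g ∷ʳ q ∷ʳ q) ⊕ c ᵛ*ᴹ zipWith (λ g aᵢ → g ∷ʳ aᵢ ∷ʳ aᵢ) G a
    ≡⟨ cong₂ _⊕_ (trans (map-∷ʳ (p *₂_) q (g ∷ʳ q)) (cong (_∷ʳ p *₂ q) (map-∷ʳ (p *₂_) q g)))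
                 (ᵛ*ᴹ-extended c G a) ⟩
  (map (p *₂_) g ∷ʳ p *₂ q ∷ʳ p *₂ q) ⊕ (c ᵛ*ᴹ G ∷ʳ c ∙ a ∷ʳ c ∙ a)
    ≡⟨ ⊕-∷ʳ² (map (p *₂_) g) (c ᵛ*ᴹ G) (p *₂ q) (p *₂ q) (c ∙ a) (c ∙ a) ⟩
  (map (p *₂_) g ⊕ c ᵛ*ᴹ G) ∷ʳ (p *₂ q +₂ c ∙ a) ∷ʳ (p *₂ q +₂ c ∙ a) ∎

1+p≢0+p : ∀ p → 1ℙ +₂ p ≢ 0ℙ +₂ p
1+p≢0+p 0ℙ ()
1+p≢0+p 1ℙ ()

module _ {A : LinearCode n} (S : SystematicGenerator A k) where
  open SystematicGenerator S

  -- A column serving two distinct indices `i` and `j` would have both 1 and 0 in row `i`.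
  position-injective : ∀ {i j} → position i ≡ position j → i ≡ j
  position-injective {i} {j} eq with i ≟ᶠ j | identity i i | identity i j
  ... | yes i≡j | _  | _  = i≡j
  ... | no  _   | ii | ij with i ≟ᶠ i
  ...   | no  i≢i = ⊥-elim (i≢i refl)
  ...   | yes _   = case trans (sym ii) (trans (cong (lookup (lookup G i)) eq) ij) of λ ()

  -- On the information positions, row `i` is the unit vector `unit i`.
  scatter-∙-row : (a : Vec 𝔽₂ k) (i : Fin k) → scatter position a ∙ lookup G i ≡ lookup a i
  scatter-∙-row a i = begin
    scatter position a ∙ lookup G i                    ≡⟨ scatter-∙ position-injective a (lookup G i) ⟩
    a ∙ tabulate (lookup (lookup G i) ∘ position)      ≡⟨ cong (a ∙_) (tabulate-cong row) ⟩
    a ∙ tabulate (lookup (unit i))                     ≡⟨ cong (a ∙_) (tabulate∘lookup (unit i)) ⟩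
    a ∙ unit i                                         ≡⟨ ∙-comm a (unit i) ⟩
    unit i ∙ a                                         ≡⟨ unit-∙ i a ⟩
    lookup a i                                         ∎
    where
    row : ∀ j → lookup (lookup G i) (position j) ≡ lookup (unit i) j
    row j with i ≟ᶠ j | identity i j
    ... | yes refl | eq = trans eq (sym (lookup-unit i))
    ... | no  i≢j  | eq = trans eq (sym (lookup-unit-≢ i≢j))

  codeword-combination : ∀ {x} → x ∈ Codeword A → ∃[ c ] c ᵛ*ᴹ G ≡ x
  codeword-combination = proj₁ (proj₁ isGenerator)

  module _ (a : Vec 𝔽₂ k) where

    liftedRow : Vec 𝔽₂ k → Vec 𝔽₂ (2 +ℕ n)
    liftedRow c = c ᵛ*ᴹ G ∷ʳ c ∙ a ∷ʳ c ∙ a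

    liftedRow∈child : ∀ c → liftedRow c ∈ ChildTypeCode S a
    liftedRow∈child c = (0ℙ ∷ c) , (begin
      map (0ℙ *₂_) (extraVector S a) ⊕ c ᵛ*ᴹ extendedMatrix S a
        ≡⟨ cong₂ _⊕_ (scale-0 (extraVector S a)) (ᵛ*ᴹ-extended c G a) ⟩
      𝟎 ⊕ liftedRow c
        ≡⟨ ⊕-identityˡ (liftedRow c) ⟩
      liftedRow c ∎)

    extra⊕liftedRow∈child : ∀ c → extraVector S a ⊕ liftedRow c ∈ ChildTypeCode S a
    extra⊕liftedRow∈child c =
      (1ℙ ∷ c) , cong₂ _⊕_ (scale-1 (extraVector S a)) (ᵛ*ᴹ-extended c G a)

    child-elim : ∀ {v} → v ∈ ChildTypeCode S a →
                 ∃[ c ] (v ≡ liftedRow c ⊎ v ≡ extraVector S a ⊕ liftedRow c)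
    child-elim (0ℙ ∷ c , eq) = c , inj₁ (trans (sym eq) (proj₂ (liftedRow∈child c)))
    child-elim (1ℙ ∷ c , eq) = c , inj₂ (trans (sym eq) (proj₂ (extra⊕liftedRow∈child c)))

    -- Adding the extra vector, which ends in 1 and 0, to a lifted row makes the ends differ.
    child-equalEnd : ∀ {x t} → x ∷ʳ t ∷ʳ t ∈ ChildTypeCode S a → ∃[ c ] x ∷ʳ t ∷ʳ t ≡ liftedRow c
    child-equalEnd {x} {t} xt∈ with child-elim xt∈
    ... | c , inj₁ eq = c , eq
    ... | c , inj₂ eq =
      let _ , t≡1+ , t≡0+ = ∷ʳ²-injective {x = x}
            (trans eq (⊕-∷ʳ² (scatter position a) (c ᵛ*ᴹ G) 1ℙ 0ℙ (c ∙ a) (c ∙ a)))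
      in ⊥-elim (1+p≢0+p (c ∙ a) (trans (sym t≡1+) t≡0+))

    child-isParent : {D : LinearCode (2 +ℕ n)} → Codeword D ≐ ChildTypeCode S a → IsParent A D
    child-isParent {D} (⊆ , ⊇) = record
      { puncture  = λ {x} xt∈D → let c , eq = child-equalEnd (⊆ xt∈D) in
          proj₂ (proj₁ isGenerator) (c , sym (proj₁ (∷ʳ²-injective {x = x} eq)))
      ; lift      = λ x∈A → let c , eq = codeword-combination x∈A in
          c ∙ a , subst (λ x → x ∷ʳ c ∙ a ∷ʳ c ∙ a ∈ Codeword D) eq (⊇ (liftedRow∈child c))
      -- If `lastTwo` were a lifted row, its coefficients `c` would satisfy `c ᵛ*ᴹ G ≡ 𝟎`, so `c`
      -- would vanish by independence, yet `c ∙ a` would be 1.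
      ; separated = λ w∈D →
          let c , eq       = child-equalEnd (⊆ w∈D)
              𝟎≡cG , 1≡ , _ = ∷ʳ²-injective {x = 𝟎} eq
              c≡𝟎          = proj₂ isGenerator c (sym 𝟎≡cG)
          in case trans 1≡ (trans (cong (_∙ a) c≡𝟎) (∙-zeroˡ a)) of λ ()
      }

-- The converse: up to swapping the last two coordinates, a self-dual code with
-- parent A is the child type code given by the lifts of the rows of G.
module _ {A : LinearCode n} (S : SystematicGenerator A k) (a : Vec 𝔽₂ k)
         {C : LinearCode (2 +ℕ n)} (parent : IsParent A C)
         (rows : ∀ i → lookup (SystematicGenerator.G S) i ∷ʳ lookup a i ∷ʳ lookup a i ∈ Codeword C)
         where
  open SystematicGenerator S
  open IsParent parent

  liftedRow∈ : ∀ c → liftedRow S a c ∈ Codeword C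
  liftedRow∈ c = subst (Codeword C) (ᵛ*ᴹ-extended c G a)
    (ᵛ*ᴹ-closed C (extendedMatrix S a)
      (λ i → subst (Codeword C) (sym (lookup-zipWith _ i G a)) (rows i)) c)

  equalEnd : ∀ {x t} → x ∷ʳ t ∷ʳ t ∈ Codeword C → ∃[ c ] x ∷ʳ t ∷ʳ t ≡ liftedRow S a c
  equalEnd {x} {t} xt∈C with codeword-combination S (puncture xt∈C)
  ... | c , refl = c , cong (λ p → x ∷ʳ p ∷ʳ p) (lift-unique parent xt∈C (liftedRow∈ c))

  unequalEnd : ∀ {z q u} → z ∷ʳ q ⁻¹ ∷ʳ q ∈ Codeword C → u ∈ Codeword C →
               ∃[ c ] (u ≡ liftedRow S a c ⊎ u ≡ (z ∷ʳ q ⁻¹ ∷ʳ q) ⊕ liftedRow S a c)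
  unequalEnd {z} {q} z∈C u∈C with split-ends C {z} {q} z∈C u∈C
  ... | x , t , xt∈C , inj₁ refl = let c , eq = equalEnd xt∈C in c , inj₁ eq
  ... | x , t , xt∈C , inj₂ refl = let c , eq = equalEnd xt∈C in
    c , inj₂ (cong ((z ∷ʳ q ⁻¹ ∷ʳ q) ⊕_) eq)

  -- The extra vector has unequal ends, with `q` equal to 0, so the code is the span of the lifted
  -- rows together with its translate by that vector.
  extra∈⇒child : extraVector S a ∈ Codeword C → Codeword C ≐ ChildTypeCode S a
  extra∈⇒child extra∈C = ⊆ , ⊇
    where
    ⊆ : ∀ {u} → u ∈ Codeword C → u ∈ ChildTypeCode S a
    ⊆ u∈C with unequalEnd extra∈C u∈C
    ... | c , inj₁ refl = liftedRow∈child S a c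
    ... | c , inj₂ refl = extra⊕liftedRow∈child S a c
    ⊇ : ∀ {u} → u ∈ ChildTypeCode S a → u ∈ Codeword C
    ⊇ u∈ with child-elim S a u∈
    ... | c , inj₁ refl = liftedRow∈ c
    ... | c , inj₂ refl = LinearCode.⊕-closed C extra∈C (liftedRow∈ c)

  module _ (selfDual : Codeword C ≐ Dual C)
           {z : Vec 𝔽₂ n} {q : 𝔽₂} (z∈C : z ∷ʳ q ⁻¹ ∷ʳ q ∈ Codeword C) where

    -- extraVector S a for p ≡ 0ℙ, and its swap for p ≡ 1ℙ
    extra : 𝔽₂ → Vec 𝔽₂ (2 +ℕ n)
    extra p = scatter position a ∷ʳ p ⁻¹ ∷ʳ p

    p⁻¹r+r+pr≡0 : ∀ p r → r +₂ p ⁻¹ *₂ r +₂ p *₂ r ≡ 0ℙ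
    p⁻¹r+r+pr≡0 0ℙ 0ℙ = refl
    p⁻¹r+r+pr≡0 0ℙ 1ℙ = refl
    p⁻¹r+r+pr≡0 1ℙ 0ℙ = refl
    p⁻¹r+r+pr≡0 1ℙ 1ℙ = refl

    -- The scattered part contributes `aᵢ`, and exactly one of the two ends contributes a second
    -- `aᵢ`.
    extra-∙-row : ∀ p i → (lookup G i ∷ʳ lookup a i ∷ʳ lookup a i) ∙ extra p ≡ 0ℙ
    extra-∙-row p i = begin
      (lookup G i ∷ʳ aᵢ ∷ʳ aᵢ) ∙ extra p
        ≡⟨ ∙-comm (lookup G i ∷ʳ aᵢ ∷ʳ aᵢ) (extra p) ⟩
      extra p ∙ (lookup G i ∷ʳ aᵢ ∷ʳ aᵢ)
        ≡⟨ ∙-∷ʳ² (scatter position a) (lookup G i) (p ⁻¹) p aᵢ aᵢ ⟩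
      scatter position a ∙ lookup G i +₂ p ⁻¹ *₂ aᵢ +₂ p *₂ aᵢ
        ≡⟨ cong (λ r → r +₂ p ⁻¹ *₂ aᵢ +₂ p *₂ aᵢ) (scatter-∙-row S a i) ⟩
      aᵢ +₂ p ⁻¹ *₂ aᵢ +₂ p *₂ aᵢ
        ≡⟨ p⁻¹r+r+pr≡0 p aᵢ ⟩
      0ℙ ∎
      where aᵢ = lookup a i

    extra-∙-liftedRow : ∀ p c → liftedRow S a c ∙ extra p ≡ 0ℙ
    extra-∙-liftedRow p c = begin
      liftedRow S a c ∙ extra p
        ≡⟨ cong (_∙ extra p) (ᵛ*ᴹ-extended c G a) ⟨
      (c ᵛ*ᴹ extendedMatrix S a) ∙ extra p
        ≡⟨ ᵛ*ᴹ-∙ c (extendedMatrix S a) (extra p) ⟩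
      c ∙ (extendedMatrix S a ᴹ*ᵛ extra p)
        ≡⟨ cong (c ∙_) (lookup-ext zeros) ⟩
      c ∙ 𝟎
        ≡⟨ ∙-zeroʳ c ⟩
      0ℙ ∎
      where
      zeros : ∀ i → lookup (extendedMatrix S a ᴹ*ᵛ extra p) i ≡ lookup 𝟎 i
      zeros i = begin
        lookup (extendedMatrix S a ᴹ*ᵛ extra p) i
          ≡⟨ lookup-map i (_∙ extra p) (extendedMatrix S a) ⟩
        lookup (extendedMatrix S a) i ∙ extra p
          ≡⟨ cong (_∙ extra p) (lookup-zipWith _ i G a) ⟩
        (lookup G i ∷ʳ lookup a i ∷ʳ lookup a i) ∙ extra p
          ≡⟨ extra-∙-row p i ⟩
        0ℙ
          ≡⟨ lookup-replicate i 0ℙ ⟨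
        lookup 𝟎 i ∎

    -- Both candidates are orthogonal to all lifted rows; orthogonality to the one remaining coset
    -- representative puts a candidate into the self-dual code.
    extra∈ : ∀ p → (z ∷ʳ q ⁻¹ ∷ʳ q) ∙ extra p ≡ 0ℙ → extra p ∈ Codeword C
    extra∈ p z∙extra≡0 = proj₂ selfDual orthogonal
      where
      orthogonal : ∀ u → u ∈ Codeword C → u ∙ extra p ≡ 0ℙ
      orthogonal u u∈C with unequalEnd z∈C u∈C
      ... | c , inj₁ refl = extra-∙-liftedRow p c
      ... | c , inj₂ refl = trans (∙-distribʳ (extra p) (z ∷ʳ q ⁻¹ ∷ʳ q) (liftedRow S a c))
                                  (cong₂ _+₂_ z∙extra≡0 (extra-∙-liftedRow p c))

    -- The two candidates differ by `lastTwo`, whose product with a word with unequal ends is 1; so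
    -- one of them is orthogonal to that word.
    some-extra∈ : ∃[ p ] extra p ∈ Codeword C
    some-extra∈ = p , extra∈ p
      (trans (∙-∷ʳ² z (scatter position a) (q ⁻¹) q (p ⁻¹) p) (solve (z ∙ scatter position a) q))
      where
      -- The ends contribute 1 to the product exactly when `p` equals `q`, so this must happen
      -- exactly when the remaining product is 1.
      p = z ∙ scatter position a +₂ q ⁻¹
      solve : ∀ r q → r +₂ q ⁻¹ *₂ (r +₂ q ⁻¹) ⁻¹ +₂ q *₂ (r +₂ q ⁻¹) ≡ 0ℙ
      solve 0ℙ 0ℙ = refl
      solve 0ℙ 1ℙ = refl
      solve 1ℙ 0ℙ = refl
      solve 1ℙ 1ℙ = refl

    -- A codeword of a self-dual code is orthogonal to itself. For `extra p` the ends contribute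
    -- exactly 1, so the scattered part must contribute 1 as well.
    lifts-odd : OddWeight a
    lifts-odd = let p , e∈C = some-extra∈ in begin
      parity (weight a)                           ≡⟨ parity-weight a ⟩
      a ∙ a                                       ≡⟨ scatter-∙-scatter (position-injective S) a ⟨
      scatter position a ∙ scatter position a     
        ≡⟨ odd p (trans (sym (∙-∷ʳ² (scatter position a) (scatter position a) (p ⁻¹) p (p ⁻¹) p))
                        (proj₁ selfDual e∈C (extra p) e∈C)) ⟩
      1ℙ                                          ∎
      where
      odd : ∀ {r} p → r +₂ p ⁻¹ *₂ p ⁻¹ +₂ p *₂ p ≡ 0ℙ → r ≡ 1ℙ
      odd {1ℙ} _  _ = refl
      odd {0ℙ} 0ℙ ()
      odd {0ℙ} 1ℙ ()

-- Construction of the parent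

drop² : Vec 𝔽₂ (2 +ℕ n) → Vec 𝔽₂ n
drop² u = proj₁ (snoc² u)

drop²-∷ʳ² : (x : Vec 𝔽₂ n) (s t : 𝔽₂) → drop² (x ∷ʳ s ∷ʳ t) ≡ x
drop²-∷ʳ² x s t with snoc² (x ∷ʳ s ∷ʳ t)
... | y , p , q , eq = sym (proj₁ (∷ʳ²-injective {x = x} eq))

drop²-additive : Additive (drop² {n})
drop²-additive u v with snoc² u | snoc² v
... | x , p , q , refl | y , s , t , refl =
  trans (cong drop² (⊕-∷ʳ² x y p q s t)) (drop²-∷ʳ² (x ⊕ y) (p +₂ s) (q +₂ t))

equalEnds : (u : Vec 𝔽₂ (2 +ℕ n)) → u ∙ lastTwo ≡ 0ℙ → ∃[ t ] u ≡ drop² u ∷ʳ t ∷ʳ t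
equalEnds u u∙w≡0 with snoc² u
... | x , s , t , refl with p+q≡0⇒p≡q s t (trans (sym (∙-lastTwo x s t)) u∙w≡0)
...   | refl = s , refl

module _ (X : Ω (suc k)) (separated : ¬ (lastTwo ∈ Codeword (code X))) where
  private
    C = code X
    G = proj₁ (Ω.dimension X)
    ⊆ = proj₁ (proj₁ (proj₂ (Ω.dimension X)))
    ⊇ = proj₂ (proj₁ (proj₂ (Ω.dimension X)))
    independent = proj₂ (proj₂ (Ω.dimension X))

    -- Its product with a coefficient vector is the sum of the last two entries of the corresponding
    -- codeword.
    functional : Vec 𝔽₂ (suc k)
    functional = G ᴹ*ᵛ lastTwo

    functional≢𝟎 : functional ≢ 𝟎
    -- Otherwise `lastTwo` would be orthogonal to the whole code and hence lie in it.
    functional≢𝟎 eq = separated (proj₂ (Ω.selfDual X) orthogonal)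
      where
      orthogonal : ∀ u → u ∈ Codeword C → u ∙ lastTwo ≡ 0ℙ
      orthogonal u u∈C with ⊆ u∈C
      ... | c , refl = trans (ᵛ*ᴹ-∙ c G lastTwo) (trans (cong (c ∙_) eq) (∙-zeroʳ c))

    module H = Hyperplane (hyperplane functional functional≢𝟎)

  oddWord : ∃[ z ] ∃[ q ] z ∷ʳ q ⁻¹ ∷ʳ q ∈ Codeword C
  oddWord = word (H.outside ᵛ*ᴹ G) (⊇ (H.outside , refl))
                 (trans (ᵛ*ᴹ-∙ H.outside G lastTwo) H.outside-∙)
    where
    unequal : ∀ s t → s +₂ t ≡ 1ℙ → s ≡ t ⁻¹
    unequal 0ℙ 1ℙ _ = refl
    unequal 1ℙ 0ℙ _ = refl
    word : ∀ u → u ∈ Codeword C → u ∙ lastTwo ≡ 1ℙ → ∃[ z ] ∃[ q ] z ∷ʳ q ⁻¹ ∷ʳ q ∈ Codeword C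
    word u u∈C u∙w≡1 with snoc² u
    ... | x , s , t , refl with unequal s t (trans (sym (∙-lastTwo x s t)) u∙w≡1)
    ...   | refl = x , t , u∈C

  parentCode : LinearCode (k * 2)
  parentCode = record
    { Codeword = λ x → ∃[ t ] x ∷ʳ t ∷ʳ t ∈ Codeword C
    ; 𝟎∈       = 0ℙ , subst (Codeword C)
                   (sym (trans (cong (_∷ʳ 0ℙ) (𝟎-∷ʳ (k * 2))) (𝟎-∷ʳ (suc (k * 2)))))
                   (LinearCode.𝟎∈ C)
    ; ⊕-closed = λ {x} {y} (s , xs∈C) (t , yt∈C) →
        s +₂ t , subst (Codeword C) (⊕-∷ʳ² x y s s t t) (LinearCode.⊕-closed C xs∈C yt∈C)
    }

  parent-isParent : IsParent parentCode C
  parent-isParent = record { puncture = λ xt∈C → _ , xt∈C ; lift = id ; separated = separated }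

  -- Equal ends contribute twice the same product, so they cancel and orthogonality passes between
  -- words and their lifts.
  parent-selfDual : Codeword parentCode ≐ Dual parentCode
  parent-selfDual =
    (λ {y} (t , yt∈C) x (s , xs∈C) → trans (sym (cancel (x ∙ y) (s *₂ t)))
      (trans (sym (∙-∷ʳ² x y s s t t)) (proj₁ (Ω.selfDual X) yt∈C (x ∷ʳ s ∷ʳ s) xs∈C)))
    -- The end `z ∙ y` is the one that makes the lift of `y` orthogonal also to the word with
    -- unequal ends.
    , λ {y} y∈dual → let s = z ∙ y in
        s , proj₂ (Ω.selfDual X) (orthogonal y y∈dual)
    where
    z = proj₁ oddWord
    q = proj₁ (proj₂ oddWord)
    z∈C = proj₂ (proj₂ oddWord)

    cancel : ∀ r p → r +₂ p +₂ p ≡ r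
    cancel r p = trans (ℙ.+-assoc r p p) (trans (cong (r +₂_) (ℙ.p+p≡0ℙ p)) (ℙ.+-identityʳ r))

    vanish : ∀ s q → s +₂ q ⁻¹ *₂ s +₂ q *₂ s ≡ 0ℙ
    vanish 0ℙ 0ℙ = refl
    vanish 0ℙ 1ℙ = refl
    vanish 1ℙ 0ℙ = refl
    vanish 1ℙ 1ℙ = refl

    module _ (y : Vec 𝔽₂ (k * 2)) (y∈dual : y ∈ Dual parentCode) where
      s = z ∙ y

      orthogonal-equal : ∀ x t → x ∷ʳ t ∷ʳ t ∈ Codeword C → (x ∷ʳ t ∷ʳ t) ∙ (y ∷ʳ s ∷ʳ s) ≡ 0ℙ
      orthogonal-equal x t xt∈C =
        trans (∙-∷ʳ² x y t t s s) (trans (cancel (x ∙ y) (t *₂ s)) (y∈dual x (t , xt∈C)))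

      orthogonal : ∀ u → u ∈ Codeword C → u ∙ (y ∷ʳ s ∷ʳ s) ≡ 0ℙ
      orthogonal u u∈C with split-ends C {z} {q} z∈C u∈C
      ... | x , t , xt∈C , inj₁ refl = orthogonal-equal x t xt∈C
      ... | x , t , xt∈C , inj₂ refl =
        trans (∙-distribʳ (y ∷ʳ s ∷ʳ s) (z ∷ʳ q ⁻¹ ∷ʳ q) (x ∷ʳ t ∷ʳ t))
          (cong₂ _+₂_ (trans (∙-∷ʳ² z y (q ⁻¹) q s s) (vanish s q)) (orthogonal-equal x t xt∈C))

  -- The coefficient vectors of words with equal ends form a hyperplane, which lowers the dimension
  -- by one. Deleting the ends loses nothing more, since `lastTwo` is not a codeword.
  parentΩ : Ω k
  parentΩ = record
    { code      = parentCode
    ; selfDual  = parent-selfDual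
    ; dimension = hasDimension parentCode (λ c → drop² (word c)) additive injective image surjective
    }
    where
    word : Vec 𝔽₂ k → Vec 𝔽₂ (2 +ℕ k * 2)
    word c = H.embed c ᵛ*ᴹ G

    ends : ∀ c → ∃[ t ] word c ≡ drop² (word c) ∷ʳ t ∷ʳ t
    ends c = equalEnds (word c) (trans (ᵛ*ᴹ-∙ (H.embed c) G lastTwo) (H.orthogonal c))

    additive : Additive (λ c → drop² (word c))
    additive c d = begin
      drop² (word (c ⊕ d))                   ≡⟨ cong (λ e → drop² (e ᵛ*ᴹ G)) (H.additive c d) ⟩
      drop² ((H.embed c ⊕ H.embed d) ᵛ*ᴹ G)  ≡⟨ cong drop² (ᵛ*ᴹ-distribʳ (H.embed c) (H.embed d) G) ⟩
      drop² (word c ⊕ word d)                ≡⟨ drop²-additive (word c) (word d) ⟩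
      drop² (word c) ⊕ drop² (word d)        ∎

    injective : ∀ c → drop² (word c) ≡ 𝟎 → c ≡ 𝟎
    injective c eq = H.injective c (independent (H.embed c) word≡𝟎)
      where
      t = proj₁ (ends c)
      word≡ : word c ≡ 𝟎 ∷ʳ t ∷ʳ t
      word≡ = trans (proj₂ (ends c)) (cong (λ x → x ∷ʳ t ∷ʳ t) eq)
      t≡0 : t ≡ 0ℙ
      t≡0 = separated⇒≡0 C separated t (⊇ (H.embed c , word≡))
      word≡𝟎 : word c ≡ 𝟎
      word≡𝟎 = trans word≡ (trans (cong (λ t → 𝟎 ∷ʳ t ∷ʳ t) t≡0)
        (trans (cong (_∷ʳ 0ℙ) (𝟎-∷ʳ (k * 2))) (𝟎-∷ʳ (suc (k * 2)))))

    image : ∀ c → drop² (word c) ∈ Codeword parentCode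
    image c = let t , eq = ends c in t , ⊇ (H.embed c , eq)

    surjective : ∀ {x} → x ∈ Codeword parentCode → ∃[ c ] drop² (word c) ≡ x
    surjective {x} (t , xt∈C) =
      let d , dG≡xt  = ⊆ xt∈C
          d∙v≡0      = trans (sym (ᵛ*ᴹ-∙ d G lastTwo))
                         (trans (cong (_∙ lastTwo) dG≡xt) (trans (∙-lastTwo x t t) (ℙ.p+p≡0ℙ t)))
          c , embed≡ = H.surjective d d∙v≡0
      in c , trans (cong drop² (trans (cong (_ᵛ*ᴹ G) embed≡) dG≡xt)) (drop²-∷ʳ² x t t)

-- Orbits

restricts-extend² : (σ : Permutation′ n) → Restricts (extend² σ) σ
restricts-extend² σ x t = permute-extend² σ x t t

restricts-swapLast : Restricts (swapLast {n}) Perm.id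
restricts-swapLast x t =
  trans (permute-swapLast x t t) (cong (λ y → y ∷ʳ t ∷ʳ t) (sym (permute-id x)))

restricts-id : Restricts (Perm.id {2 +ℕ n}) Perm.id
restricts-id x t =
  trans (permute-id (x ∷ʳ t ∷ʳ t)) (cong (λ y → y ∷ʳ t ∷ʳ t) (sym (permute-id x)))

unit-ᵛ*ᴹ : (i : Fin m) (G : Matrix m n) → unit i ᵛ*ᴹ G ≡ lookup G i
unit-ᵛ*ᴹ i G = lookup-ext λ p → begin
  lookup (unit i ᵛ*ᴹ G) p             ≡⟨ lookup-ᵛ*ᴹ (unit i) G p ⟩
  unit i ∙ map (λ g → lookup g p) G   ≡⟨ unit-∙ i (map (λ g → lookup g p) G) ⟩
  lookup (map (λ g → lookup g p) G) i ≡⟨ lookup-map i (λ g → lookup g p) G ⟩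
  lookup (lookup G i) p               ∎

module _ {A : LinearCode n} (S : SystematicGenerator A k) where
  open SystematicGenerator S

  row∈ : ∀ i → lookup G i ∈ Codeword A
  row∈ i = proj₂ (proj₁ isGenerator) (unit i , unit-ᵛ*ᴹ i G)

  RowLifts : LinearCode (2 +ℕ n) → Vec 𝔽₂ k → Set
  RowLifts C a = ∀ i → lookup G i ∷ʳ lookup a i ∷ʳ lookup a i ∈ Codeword C

  rowLifts : {C : LinearCode (2 +ℕ n)} → IsParent A C → ∃ (RowLifts C)
  rowLifts {C} P = tabulate (λ i → proj₁ (lift (row∈ i))) , λ i →
    subst (λ t → lookup G i ∷ʳ t ∷ʳ t ∈ Codeword C)
          (sym (lookup∘tabulate (λ i → proj₁ (lift (row∈ i))) i)) (proj₂ (lift (row∈ i)))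
    where open IsParent P

  child-rowLifts : {D : LinearCode (2 +ℕ n)} {a : Vec 𝔽₂ k} →
                   Codeword D ≐ ChildTypeCode S a → RowLifts D a
  child-rowLifts {D} {a} (_ , ⊇) i = subst (Codeword D)
    (cong₂ (λ g t → g ∷ʳ t ∷ʳ t) (unit-ᵛ*ᴹ i G) (unit-∙ i a)) (⊇ (liftedRow∈child S a (unit i)))

  -- The restriction `σ` is an automorphism since both codes have parent `A`. Row `i` of `M`
  -- expresses the image of the `i`-th generator in `G`. Note that `M` takes `a′` to `a`, against
  -- the direction of `τ`.
  sameOrbit : {D D′ : LinearCode (2 +ℕ n)} → IsParent A D → IsParent A D′ →
              {a a′ : Vec 𝔽₂ k} → RowLifts D a → RowLifts D′ a′ →
              {τ : Permutation′ (2 +ℕ n)} {σ : Permutation′ n} →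
              Carries τ D D′ → Restricts τ σ → SameOrbit S a′ a
  sameOrbit {D} {D′} P P′ {a} {a′} rows rows′ {τ} {σ} c restricts =
    σ , carries⇒image automorphism , M , lookup-ext GP≡MG , lookup-ext Ma′≡a
    where
    automorphism : Carries σ A A
    automorphism = carries-parent P P′ c restricts

    image : ∀ i → ∃[ d ] d ᵛ*ᴹ G ≡ permute σ (lookup G i)
    image i = codeword-combination S (Carries.to automorphism (row∈ i))

    M : Matrix k k
    M = tabulate (proj₁ ∘ image)

    lookup-M : ∀ i → lookup M i ≡ proj₁ (image i)
    lookup-M = lookup∘tabulate (proj₁ ∘ image)

    GP≡MG : ∀ i → lookup (map (permute σ) G) i ≡ lookup (M ᴹ*ᴹ G) i
    GP≡MG i = begin
      lookup (map (permute σ) G) i  ≡⟨ lookup-map i (permute σ) G ⟩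
      permute σ (lookup G i)        ≡⟨ proj₂ (image i) ⟨
      proj₁ (image i) ᵛ*ᴹ G         ≡⟨ cong (_ᵛ*ᴹ G) (lookup-M i) ⟨
      lookup M i ᵛ*ᴹ G              ≡⟨ lookup-map i (_ᵛ*ᴹ G) M ⟨
      lookup (M ᴹ*ᴹ G) i            ∎

    Ma′≡a : ∀ i → lookup (M ᴹ*ᵛ a′) i ≡ lookup a i
    Ma′≡a i = begin
      lookup (M ᴹ*ᵛ a′) i    ≡⟨ lookup-map i (_∙ a′) M ⟩
      lookup M i ∙ a′        ≡⟨ cong (_∙ a′) (lookup-M i) ⟩
      -- Both sides are ends of lifts of the same word to `D′`: one from the rows of `D′`, one by
      -- moving a row of `D` along `τ`.
      proj₁ (image i) ∙ a′   ≡⟨ lift-unique P′ {x = permute σ (lookup G i)} lift₁ lift₂ ⟩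
      lookup a i             ∎
      where
      d = proj₁ (image i)
      lift₁ : permute σ (lookup G i) ∷ʳ d ∙ a′ ∷ʳ d ∙ a′ ∈ Codeword D′
      lift₁ = subst (λ x → x ∷ʳ d ∙ a′ ∷ʳ d ∙ a′ ∈ Codeword D′) (proj₂ (image i))
                (liftedRow∈ S a′ P′ rows′ d)
      lift₂ : permute σ (lookup G i) ∷ʳ lookup a i ∷ʳ lookup a i ∈ Codeword D′
      lift₂ = subst (Codeword D′) (restricts (lookup G i) (lookup a i)) (Carries.to c (rows i))

  -- In `C` the moved generator `permute σ g` lifts with end `bᵢ`, by the matrix identities. The
  -- inverse of `σ` takes it back to `g` and leaves the ends alone.
  orbit-rowLifts : {C : LinearCode (2 +ℕ n)} → IsParent A C → {a b : Vec 𝔽₂ k} →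
                   RowLifts C a → ((σ , _) : SameOrbit S a b) →
                   RowLifts (permuteCode (extend² (flip σ)) C) b
  orbit-rowLifts {C} P {a} {b} rows (σ , _ , M , GP≡MG , Ma≡b) i =
    subst (Codeword (permuteCode (extend² (flip σ)) C)) moved
      (Carries.to (carries-permuteCode (extend² (flip σ)) C) σg∈C)
    where
    g = lookup G i
    bᵢ = lookup b i

    image : lookup M i ᵛ*ᴹ G ≡ permute σ g
    image = begin
      lookup M i ᵛ*ᴹ G              ≡⟨ lookup-map i (_ᵛ*ᴹ G) M ⟨
      lookup (M ᴹ*ᴹ G) i            ≡⟨ cong (λ N → lookup N i) GP≡MG ⟨
      lookup (map (permute σ) G) i  ≡⟨ lookup-map i (permute σ) G ⟩
      permute σ g                   ∎

    coefficient : lookup M i ∙ a ≡ bᵢ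
    coefficient = trans (sym (lookup-map i (_∙ a) M)) (cong (λ v → lookup v i) Ma≡b)

    σg∈C : permute σ g ∷ʳ bᵢ ∷ʳ bᵢ ∈ Codeword C
    σg∈C = subst (Codeword C) (cong₂ (λ x t → x ∷ʳ t ∷ʳ t) image coefficient)
             (liftedRow∈ S a P rows (lookup M i))

    moved : permute (extend² (flip σ)) (permute σ g ∷ʳ bᵢ ∷ʳ bᵢ) ≡ g ∷ʳ bᵢ ∷ʳ bᵢ
    moved = trans (permute-extend² (flip σ) (permute σ g) bᵢ bᵢ)
                  (cong (λ x → x ∷ʳ bᵢ ∷ʳ bᵢ) (permute-flipˡ σ g))

-- Equivalences preserving the last two coordinates

-- The ends are preserved as a set only; they may be swapped.
EquivalentFixingEnds : Ω (suc k) → Ω (suc k) → Set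
EquivalentFixingEnds C D = ∃[ τ ] Carries τ (code C) (code D) × PreservesLastTwo τ

fixingEnds-trans : {B C D : Ω (suc k)} → EquivalentFixingEnds B C → EquivalentFixingEnds C D →
                   EquivalentFixingEnds B D
fixingEnds-trans (σ , c , p) (τ , d , q) = σ ∘ₚ τ , carries-∘ c d , preserves-∘ σ τ p q

permuteΩ-fixingEnds : (C : Ω (suc k)) (τ : Permutation′ (suc k * 2)) → PreservesLastTwo τ →
                      EquivalentFixingEnds C (permuteΩ τ C)
permuteΩ-fixingEnds C τ p = τ , carries-permuteCode τ (code C) , p

child-fixingEnds : {A : Ω k} (S : SystematicGenerator (code A) k) {C : Ω (suc k)} →
                   IsParent (code A) (code C) → (a : Vec 𝔽₂ k) → RowLifts S (code C) a →
                   ∃[ B ] Codeword (code B) ≐ ChildTypeCode S a × EquivalentFixingEnds C B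
child-fixingEnds {k} {A} S {C} P a rows
  with z , q , z∈C ← oddWord C (IsParent.separated P)
  with some-extra∈ S a P rows (Ω.selfDual C) {z} {q} z∈C
... | 0ℙ , extra∈C = C , extra∈⇒child S a P rows extra∈C
                   , (Perm.id , carries-id (id , id) , inj₁ (refl , refl))
-- The codeword found ends in 0 and 1. Swapping the ends turns it into the extra vector and leaves
-- the lifted rows unchanged.
... | 1ℙ , extra∈C = B , extra∈⇒child S a P′ rows′ (swapped extra∈C)
                   , permuteΩ-fixingEnds C swapLast (inj₂ (swapLast-swaps {k * 2}))
  where
  B = permuteΩ swapLast C
  swapped : ∀ {x s t} → x ∷ʳ s ∷ʳ t ∈ Codeword (code C) → x ∷ʳ t ∷ʳ s ∈ Codeword (code B)
  swapped {x} {s} {t} u∈C = subst (Codeword (code B)) (permute-swapLast x s t)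
    (Carries.to (carries-permuteCode swapLast (code C)) u∈C)
  P′ : IsParent (code A) (code B)
  P′ = transport-parent P (carries-permuteCode swapLast (code C)) restricts-swapLast
         (carries-id {C = code A} {code A} (id , id))
  rows′ : RowLifts S (code B) a
  rows′ i = swapped {lookup (SystematicGenerator.G S) i} (rows i)

-- The lifts of the rows have odd weight, so their orbit has a chosen representative; moving `C` by
-- the inverse of the automorphism concerned makes the lifts equal to it.
chosenChild-fixingEnds : {A : Ω k} (choice : ChildChoice A) {C : Ω (suc k)} →
                         IsParent (code A) (code C) →
                         ∃[ B ] B ∈ ChildChoice.Child choice × EquivalentFixingEnds C B
chosenChild-fixingEnds {k} {A} choice {C} P =
  let a , rows                  = rowLifts systematic P
      z , q , z∈C               = oddWord C (IsParent.separated P)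
      odd                       = lifts-odd systematic a P rows (Ω.selfDual C) {z} {q} z∈C
      b , (b∈Reps , orbit) , _  = reps-perOrbit a odd
      σ , σ-automorphism , _    = orbit
      τ                         = extend² (flip σ)
      P′ = transport-parent P (carries-permuteCode τ (code C)) (restricts-extend² (flip σ))
             (carries-flip (image⇒carries {C = code A} {code A} {σ} σ-automorphism))
      B , B≐child , C↔B = child-fixingEnds {A = A} systematic {permuteΩ τ C} P′ b
                            (orbit-rowLifts systematic P rows orbit)
  in B , (b , b∈Reps , B≐child)
     , fixingEnds-trans {B = C} {permuteΩ τ C} {B}
         (permuteΩ-fixingEnds C τ (inj₁ (extend²-fixes (flip σ)))) C↔B
  where open ChildChoice choice

-- Extending the equivalence of parents by the identity on the ends replaces an equivalent parent by
-- `A` itself.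
reparentedChild : {A : Ω k} (choice : ChildChoice A) (C : Ω (suc k))
                  (separated : ¬ (lastTwo ∈ Codeword (code C))) →
                  ∃[ σ ] Carries σ (parentCode C separated) (code A) →
                  ∃[ B ] B ∈ ChildChoice.Child choice × EquivalentFixingEnds C B
reparentedChild {A = A} choice C separated (σ , c) =
  extendEquivalence (chosenChild-fixingEnds {A = A} choice {D} parent)
  where
  D = permuteΩ (extend² σ) C
  parent : IsParent (code A) (code D)
  parent = transport-parent (parent-isParent C separated)
             (carries-permuteCode (extend² σ) (code C)) (restricts-extend² σ) c
  extendEquivalence : ∃[ B ] B ∈ ChildChoice.Child choice × EquivalentFixingEnds D B →
                      ∃[ B ] B ∈ ChildChoice.Child choice × EquivalentFixingEnds C B
  extendEquivalence (B , B∈Child , D→B) = B , B∈Child ,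
    fixingEnds-trans {B = C} {D} {B}
      (permuteΩ-fixingEnds C (extend² σ) (inj₁ (extend²-fixes σ))) D→B

-- The parent test

doubleton-cases : {i j p q : Fin n} → ⁅ i ⁆ ∪ ⁅ j ⁆ ≡ ⁅ p ⁆ ∪ ⁅ q ⁆ → p ≢ q →
                  (i ≡ p × j ≡ q) ⊎ (i ≡ q × j ≡ p)
doubleton-cases {i = i} {j} {p} {q} eq p≢q
  with member {p} (x∈p∪q⁺ (inj₁ (x∈⁅x⁆ p))) | member {q} (x∈p∪q⁺ (inj₂ (x∈⁅x⁆ q)))
  where
  member : ∀ {x} → x ∈ˢ ⁅ p ⁆ ∪ ⁅ q ⁆ → x ≡ i ⊎ x ≡ j
  member {x} x∈ with x∈p∪q⁻ ⁅ i ⁆ ⁅ j ⁆ (subst (x ∈ˢ_) (sym eq) x∈)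
  ... | inj₁ x∈i = inj₁ (x∈⁅y⁆⇒x≡y i x∈i)
  ... | inj₂ x∈j = inj₂ (x∈⁅y⁆⇒x≡y j x∈j)
... | inj₁ refl | inj₁ refl = ⊥-elim (p≢q refl)
... | inj₁ refl | inj₂ refl = inj₁ (refl , refl)
... | inj₂ refl | inj₁ refl = inj₂ (refl , refl)
... | inj₂ refl | inj₂ refl = ⊥-elim (p≢q refl)

-- The composite first undoes `σ`, bringing the last two positions to the coordinates that `φ` sends
-- to the end.
parentTest-preserves : (φ σ : Permutation′ (2 +ℕ n)) →
                       ⁅ σ ⟨$⟩ʳ (φ ⟨$⟩ˡ last) ⁆ ∪ ⁅ σ ⟨$⟩ʳ (φ ⟨$⟩ˡ penultimate) ⁆
                         ≡ ⁅ penultimate ⁆ ∪ ⁅ last ⁆ →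
                       PreservesLastTwo (flip σ ∘ₚ φ)
parentTest-preserves {n} φ σ eq with doubleton-cases eq (fromℕ≢inject₁ ∘ sym)
... | inj₁ (c₁≡ , c₂≡) = inj₂ (invert c₁≡ , invert c₂≡)
  where
  invert : ∀ {c p} → σ ⟨$⟩ʳ (φ ⟨$⟩ˡ c) ≡ p → φ ⟨$⟩ʳ (σ ⟨$⟩ˡ p) ≡ c
  invert refl = trans (cong (φ ⟨$⟩ʳ_) (inverseˡ σ)) (inverseʳ φ)
... | inj₂ (c₁≡ , c₂≡) = inj₁ (invert c₂≡ , invert c₁≡)
  where
  invert : ∀ {c p} → σ ⟨$⟩ʳ (φ ⟨$⟩ˡ c) ≡ p → φ ⟨$⟩ʳ (σ ⟨$⟩ˡ p) ≡ c
  invert refl = trans (cong (φ ⟨$⟩ʳ_) (inverseˡ σ)) (inverseʳ φ)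

preserves-parentTest : (φ τ : Permutation′ (2 +ℕ n)) → PreservesLastTwo τ →
                       ⁅ (φ ∘ₚ τ) ⟨$⟩ʳ (φ ⟨$⟩ˡ last) ⁆ ∪ ⁅ (φ ∘ₚ τ) ⟨$⟩ʳ (φ ⟨$⟩ˡ penultimate) ⁆
                         ≡ ⁅ penultimate ⁆ ∪ ⁅ last ⁆
preserves-parentTest {n} φ τ preserves = begin
  ⁅ τ ⟨$⟩ʳ (φ ⟨$⟩ʳ (φ ⟨$⟩ˡ last)) ⁆ ∪ ⁅ τ ⟨$⟩ʳ (φ ⟨$⟩ʳ (φ ⟨$⟩ˡ penultimate)) ⁆
    ≡⟨ cong₂ (λ i j → ⁅ τ ⟨$⟩ʳ i ⁆ ∪ ⁅ τ ⟨$⟩ʳ j ⁆) (inverseʳ φ) (inverseʳ φ) ⟩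
  ⁅ τ ⟨$⟩ʳ last ⁆ ∪ ⁅ τ ⟨$⟩ʳ penultimate ⁆
    ≡⟨ cases preserves ⟩
  ⁅ penultimate ⁆ ∪ ⁅ last ⁆ ∎
  where
  cases : PreservesLastTwo τ →
          ⁅ τ ⟨$⟩ʳ last ⁆ ∪ ⁅ τ ⟨$⟩ʳ penultimate ⁆ ≡ ⁅ penultimate ⁆ ∪ ⁅ last ⁆
  cases (inj₁ (p , l)) = trans (cong₂ (λ i j → ⁅ i ⁆ ∪ ⁅ j ⁆) l p) (∪-comm ⁅ last {n} ⁆ ⁅ penultimate ⁆)
  cases (inj₂ (p , l)) = cong₂ (λ i j → ⁅ i ⁆ ∪ ⁅ j ⁆) l p

-- The algorithm

module _ {cf : CanonicalForm} (choices : Choices cf) where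
  open CanonicalForm cf
  open Choices choices

  parentTest⇒canonical : (B : Ω (2 +ℕ m)) → PassesParentTest B → EquivalentFixingEnds B (ρ B)
  parentTest⇒canonical B (σ , σ-automorphism , ends) =
    flip σ ∘ₚ φ B
    , carries-∘ (carries-flip (image⇒carries {C = code B} {code B} {σ} σ-automorphism))
                (image⇒carries {C = code B} {code (ρ B)} {φ B} (φ-canonical B))
    , parentTest-preserves (φ B) σ ends

  -- The canonical permutation of `B` leads to `ρ B`, which equals `ρ X`, and `τ` leads back; the
  -- round trip is the automorphism required.
  canonical⇒parentTest : {X B : Ω (2 +ℕ m)} → B ≅ X → EquivalentFixingEnds (ρ X) B →
                         PassesParentTest B
  canonical⇒parentTest {X = X} {B} B≅X (τ , c , preserves) =
    φ B ∘ₚ τ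
    , carries⇒image (carries-∘
        (carries-≐ʳ (image⇒carries {C = code B} {code (ρ B)} {φ B} (φ-canonical B))
                    (ρ-cong {X = B} {X} B≅X)) c)
    , preserves-parentTest (φ B) τ preserves

  -- One level of the recursion, applied to a whole set of codes at once.
  Augment : ∀ {ℓ} → Pred (Ω (suc m)) ℓ → Pred (Ω (2 +ℕ m)) _
  Augment U D = ∃[ A ] A ∈ U × D ∈ Child A × PassesParentTest D

  augment-exists : ∀ {ℓ} {U : Pred (Ω (suc m)) ℓ} → AllInequivalent U →
                   (X : Ω (2 +ℕ m)) → ∃[ B ] B ∈ Augment U × B ≅ X
  augment-exists {U = U} unique X = fromParent (unique A₀)
    where
    -- The convention on canonical representatives enters here: it guarantees that `ρ X` has a
    -- parent.
    separated = unequal⇒separated (code (ρ X)) (Ω.selfDual (ρ X)) (ρ-lastTwo X)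
    A₀ = parentΩ (ρ X) separated

    fromChild : {A : Ω (suc _)} → A ∈ U →
                ∃[ B ] B ∈ Child A × EquivalentFixingEnds (ρ X) B →
                ∃[ B ] B ∈ Augment U × B ≅ X
    fromChild {A} A∈U (B , B∈Child , ρX→B) =
      B , (A , A∈U , B∈Child , canonical⇒parentTest {X = X} {B} B≅X ρX→B) , B≅X
      where
      B≅X : B ≅ X
      B≅X = ≅-trans {X = B} {ρ X} {X}
              (≅-sym {X = ρ X} {B} (carries⇒≅ {X = ρ X} {B} (proj₁ (proj₂ ρX→B)))) (ρ-≅ X)

    fromParent : ∃! _≈_ (λ A → A ∈ U × A ≅ A₀) → ∃[ B ] B ∈ Augment U × B ≅ X
    fromParent (A , (A∈U , A≅A₀) , _) =
      fromChild A∈U (reparentedChild {A = A} (childChoice A) (ρ X) separated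
        (≅⇒carries {X = A₀} {A} (≅-sym {X = A} {A₀} A≅A₀)))

  children-unique : (A : Ω m) {D D′ : Ω (suc m)} → D ∈ Child A → D′ ∈ Child A →
                    EquivalentFixingEnds D D′ → D ≈ D′
  children-unique A {D} {D′} (a , a∈Reps , D⊆ , D⊇) (a′ , a′∈Reps , D′⊆ , D′⊇) (τ , c , preserves) =
    (λ u∈D → D′⊇ (subst (λ b → _ ∈ ChildTypeCode S b) a≡a′ (D⊆ u∈D)))
    , λ u∈D′ → D⊇ (subst (λ b → _ ∈ ChildTypeCode S b) (sym a≡a′) (D′⊆ u∈D′))
    where
    open ChildChoice (childChoice A) renaming (systematic to S)
    P  = child-isParent S a {code D} (D⊆ , D⊇)
    P′ = child-isParent S a′ {code D′} (D′⊆ , D′⊇)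
    rows  = child-rowLifts S {code D} (D⊆ , D⊇)
    rows′ = child-rowLifts S {code D′} (D′⊆ , D′⊇)
    restriction = restrict τ preserves
    representative = reps-perOrbit a′ (reps-odd a′∈Reps)
    representative-unique = proj₂ (proj₂ representative)
    a≡a′ : a ≡ a′
    -- Both vectors are chosen representatives of the orbit of `a′`, the second by the identity
    -- automorphism.
    a≡a′ = trans
      (sym (representative-unique
        (a∈Reps , sameOrbit S P P′ rows rows′ {σ = proj₁ restriction} c (proj₂ restriction))))
      (representative-unique
        (a′∈Reps , sameOrbit S P′ P′ rows′ rows′ {σ = Perm.id} (carries-id (id , id)) restricts-id))

  augment-unique : ∀ {ℓ} {U : Pred (Ω (suc m)) ℓ} → AllInequivalent U →
                   {D D′ : Ω (2 +ℕ m)} → D ∈ Augment U → D′ ∈ Augment U → D ≅ D′ → D ≈ D′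
  augment-unique unique {D} {D′} (A , A∈U , D∈Child , D-passes)
                                 (A′ , A′∈U , D′∈Child , D′-passes) D≅D′ =
    children-unique A {D} {D′} D∈Child
      (proj₂ (child-cong {A = A} {A′} A≈A′) {D′} D′∈Child) D→D′
    where
    D→D′ : EquivalentFixingEnds D D′
    -- The route runs through the common canonical representative of the two codes.
    D→D′ =
      let σ , c , p = parentTest⇒canonical D D-passes
          τ , d , q = parentTest⇒canonical D′ D′-passes
      in σ ∘ₚ flip τ
         , carries-∘ (carries-≐ʳ c (ρ-cong {X = D} {D′} D≅D′)) (carries-flip d)
         , preserves-∘ σ (flip τ) p (preserves-flip τ q)

    childParent : (A : Ω (suc _)) {D : Ω (2 +ℕ _)} → D ∈ Child A → IsParent (code A) (code D)
    childParent A {D} (a , _ , D≐) = child-isParent (ChildChoice.systematic (childChoice A)) a {code D} D≐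

    restriction = restrict (proj₁ D→D′) (proj₂ (proj₂ D→D′))

    A≅A′ : A ≅ A′
    A≅A′ = carries⇒≅ {X = A} {A′} {proj₁ restriction}
      (carries-parent (childParent A {D} D∈Child) (childParent A′ {D′} D′∈Child)
        (proj₁ (proj₂ D→D′)) (proj₂ restriction))

    A≈A′ : A ≈ A′
    -- Both parents lie in `U` and in the class of `A′`, so both agree with the unique code `Q`
    -- there.
    A≈A′ =
      let Q , _ , Q-unique = unique A′
          Q⊆A , A⊆Q   = Q-unique {A} (A∈U , A≅A′)
          Q⊆A′ , A′⊆Q = Q-unique {A′} (A′∈U , ≅-refl A′)
      in (λ x∈A → Q⊆A′ (A⊆Q x∈A)) , (λ x∈A′ → Q⊆A (A′⊆Q x∈A′))

  augment-inequivalent : ∀ {ℓ} {U : Pred (Ω (suc m)) ℓ} → AllInequivalent U →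
                         AllInequivalent (Augment U)
  augment-inequivalent unique X =
    let B , B∈ , B≅X = augment-exists unique X
    in B , (B∈ , B≅X) , λ {D} (D∈ , D≅X) →
         augment-unique unique {B} {D} B∈ D∈
           (≅-trans {X = B} {X} {D} B≅X (≅-sym {X = D} {X} D≅X))

  -- Induction on the target dimension

  augmentation-refl : {A D : Ω k} → D ∈ Augmentation k A → D ≡ A
  augmentation-refl add                = refl
  augmentation-refl (recurse lt _ _ _) = ⊥-elim (<-irrefl refl lt)

  -- The recursion exposes the first step from the input. This lemma and `augmentation-unsnoc`
  -- expose the last one, as induction on the target dimension requires.
  augmentation-snoc : {A : Ω m} {P : Ω (suc k)} {D : Ω (2 +ℕ k)} →
                      P ∈ Augmentation (suc k) A → D ∈ Child P → PassesParentTest D →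
                      D ∈ Augmentation (2 +ℕ k) A
  augmentation-snoc add D∈Child passes = recurse (n<1+n _) D∈Child passes add
  augmentation-snoc (recurse lt B∈Child B-passes P∈) D∈Child passes =
    recurse (<-trans lt (n<1+n _)) B∈Child B-passes (augmentation-snoc P∈ D∈Child passes)

  augmentation-unsnoc : {A : Ω m} {D : Ω (2 +ℕ k)} → m ≤ suc k → D ∈ Augmentation (2 +ℕ k) A →
                        ∃[ P ] P ∈ Augmentation (suc k) A × D ∈ Child P × PassesParentTest D
  augmentation-unsnoc m≤1+k add = ⊥-elim (<-irrefl refl m≤1+k)
  augmentation-unsnoc {A = A} m≤1+k (recurse {B = B} _ B∈Child B-passes D∈)
    with m≤n⇒m<n∨m≡n m≤1+k
  ... | inj₁ m<1+k =
    let P , P∈ , D∈Child , passes = augmentation-unsnoc m<1+k D∈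
    in P , recurse m<1+k B∈Child B-passes P∈ , D∈Child , passes
  -- Here `A` has dimension just below the target, so its child `B` is already the output `D`.
  ... | inj₂ refl with augmentation-refl D∈
  ...   | refl = A , add , B∈Child , B-passes

  allInequivalent-resp : ∀ {ℓ ℓ′} {U : Pred (Ω k) ℓ} {V : Pred (Ω k) ℓ′} →
                         (∀ {D} → D ∈ U → D ∈ V) → (∀ {D} → D ∈ V → D ∈ U) →
                         AllInequivalent U → AllInequivalent V
  allInequivalent-resp U⊆V V⊆U unique X =
    let B , (B∈U , B≅X) , B-unique = unique X
    in B , (U⊆V {B} B∈U , B≅X) , λ {D} (D∈V , D≅X) → B-unique {D} (V⊆U {D} D∈V , D≅X)

  -- The bound `m ≤ k` admits the base case of equal dimensions, where the output is `U` itself.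
  -- Each further dimension is one application of `Augment`.
  outputInequivalent : ∀ {ℓ} (U : Pred (Ω m) ℓ) → 1 ≤ m → m ≤ k → AllInequivalent U →
                       AllInequivalent (Output U k)
  outputInequivalent U 1≤m m≤k unique with m≤n⇒m<n∨m≡n m≤k
  ... | inj₂ refl = allInequivalent-resp
    (λ {D} D∈U → D , D∈U , add)
    (λ { (A , A∈U , D∈) → subst U (sym (augmentation-refl D∈)) A∈U })
    unique
  outputInequivalent {m = suc m} {suc (suc k)} U 1≤m m≤k unique | inj₁ (s≤s m≤1+k) =
    allInequivalent-resp
      (λ { (P , (A , A∈U , P∈) , D∈Child , passes) → A , A∈U , augmentation-snoc P∈ D∈Child passes })
      (λ { (A , A∈U , D∈) → let P , P∈ , D∈Child , passes = augmentation-unsnoc m≤1+k D∈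
                            in P , (A , A∈U , P∈) , D∈Child , passes })
      (augment-inequivalent (outputInequivalent U 1≤m m≤1+k unique))

corollary10 : ∀ {ℓ : Level} (cf : CanonicalForm) (choices : Choices cf) (r k : ℕ) →
    1 ≤ r → r < k →
    (U : Pred (Ω r) ℓ) → Satisfiable U →
    AllInequivalent U →
    AllInequivalent (Choices.Output choices U k)
corollary10 cf choices r k 1≤r r<k U _ unique = outputInequivalent choices U 1≤r (<⇒≤ r<k) unique
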